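{- For all integers $n\geq 0$, $$a_{1^{2}3^{2}4^{ -3}}(4n)>0,\quad a_{1^{2}3^{2}4^{ -3}}(4n+1)<0,\quad a_{1^{2}3^{2}4^{ -3}}(4n+2)<0,\quad a_{1^{2}3^{2}4^{ -3}}(4n+3)=0.$$
   Context: For $|q|<1$ (or as formal power series in $q$) let $f_j:=(q^j;q^j)_\infty=\prod_{k\ge 1}(1-q^{jk})$ for each positive integer $j$. The integers $a_{1^{2}3^{2}4^{ -3}}(n)$, $n\ge 0$, are defined by $\sum_{n=0}^\infty a_{1^{2}3^{2}4^{ -3}}(n)q^n=\dfrac{f_1^2f_3^2}{f_4^3}$. -}

module Defs where

open import Data.Bool.Base using (if_then_else_)
open import Data.Fin.Base using (Fin; zero; suc; toℕ)
open import Data.Fin.Properties using (toℕ<n)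
open import Data.Integer.Base using (ℤ; 0ℤ; 1ℤ; _+_; _*_; _-_; -_)
import Data.Integer.Properties as ℤₚ
open import Data.Nat.Base as ℕ using (ℕ; zero; suc; NonZero; _∸_; _≤_; _<_; s≤s; z≤n)
import Data.Nat.Properties as ℕₚ
open import Data.Vec.Base using (Vec; []; _∷_; head; lookup)
open import Relation.Binary.PropositionalEquality
  using (_≡_; _≗_; refl; sym; trans; cong; cong₂; module ≡-Reasoning)
open import Relation.Nullary.Decidable using (does; dec-false)

open import Algebra.Properties.Monoid.Sum ℤₚ.+-0-monoid
  using (sum; sum-syntax; sum⁺-syntax; sum-cong-≗; sum-replicate-zero)

-- Formal power series over ℤ: A n is the coefficient of qⁿ.
-- Two series are equal when they are pointwise equal, A ≗ B.

Series : Set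
Series = ℕ → ℤ

infixl 6 _⊖_
infixl 7 _⊛_ _⊘_
infixr 8 _^_

q^ : ℕ → Series
q^ m n = if does (n ℕₚ.≟ m) then 1ℤ else 0ℤ

𝟙 : Series
𝟙 = q^ 0

_⊖_ : Series → Series → Series
(A ⊖ B) n = A n - B n

_⊛_ : Series → Series → Series
(A ⊛ B) n = ∑[ i ≤ n ] (A (toℕ i) * B (n ∸ toℕ i))

_^_ : Series → ℕ → Series
A ^ zero  = 𝟙
A ^ suc k = A ⊛ A ^ k

-- Division by a series B with constant term 1.  The equation B ⊛ C ≗ A then
-- determines C uniquely, by
--   C n = A n - Σ_{0≤i<n} B (i+1) · C (n-1-i).
-- quotientCoeffs A B n lists C n , C (n-1) , … , C 0 in this order.
-- If the constant term of B is not 1, the result need not be a quotient.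

quotientCoeffs : Series → Series → (n : ℕ) → Vec ℤ (suc n)
quotientCoeffs A B zero    = A 0 ∷ []
quotientCoeffs A B (suc n) =
  A (suc n) - (∑[ i ≤ n ] (B (suc (toℕ i)) * lookup cs i)) ∷ cs
  where cs = quotientCoeffs A B n

_⊘_ : Series → Series → Series
(A ⊘ B) n = head (quotientCoeffs A B n)

-- qPochhammer j N = (qʲ;qʲ)_N = ∏_{1≤k≤N} (1 - q^{jk})

qPochhammer : ℕ → ℕ → Series
qPochhammer j zero    = 𝟙
qPochhammer j (suc N) = (𝟙 ⊖ q^ (j ℕ.* suc N)) ⊛ qPochhammer j N

-- f j = (qʲ;qʲ)_∞ .  For j ≥ 1 the factors with k > n do not affect the
-- coefficient of qⁿ, so it can be read off from the n-th partial product
-- (f-limit).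

f : (j : ℕ) → .{{NonZero j}} → Series
f j n = qPochhammer j n n

a-1²3²4⁻³ : Series
a-1²3²4⁻³ = (f 1 ^ 2 ⊛ f 3 ^ 2) ⊘ f 4 ^ 3

q^-below : ∀ {m n} → n < m → q^ m n ≡ 0ℤ
q^-below {m} {n} n<m
  rewrite dec-false (n ℕₚ.≟ m) (ℕₚ.<⇒≢ n<m) = refl

sum-zero : ∀ {n} (t : Fin n → ℤ) → (∀ i → t i ≡ 0ℤ) → sum t ≡ 0ℤ
sum-zero {n} t t≡0 = trans (sum-cong-≗ t≡0) (sum-replicate-zero n)

factor-below : ∀ {m n} (A : Series) → n < m → ((𝟙 ⊖ q^ m) ⊛ A) n ≡ A n
factor-below {m} {n} A n<m = begin
  (1ℤ - q^ m 0) * A n + sum tail  ≡⟨ cong₂ _+_ first (sum-zero tail rest) ⟩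
  A n + 0ℤ                        ≡⟨ ℤₚ.+-identityʳ (A n) ⟩
  A n                             ∎
  where
  open ≡-Reasoning
  tail : Fin n → ℤ
  tail i = (𝟙 ⊖ q^ m) (suc (toℕ i)) * A (n ∸ suc (toℕ i))
  first : (1ℤ - q^ m 0) * A n ≡ A n
  first = trans
    (cong (λ z → (1ℤ - z) * A n) (q^-below (ℕₚ.≤-<-trans z≤n n<m)))
    (ℤₚ.*-identityˡ (A n))
  rest : ∀ i → tail i ≡ 0ℤ
  rest i = cong (λ z → (0ℤ - z) * A (n ∸ suc (toℕ i)))
    (q^-below (ℕₚ.≤-<-trans (toℕ<n i) n<m))

f-limit : ∀ j .{{_ : NonZero j}} {n N} → n ≤ N → qPochhammer j N n ≡ f j n
f-limit j n≤N = go (ℕₚ.≤⇒≤′ n≤N)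
  where
  go : ∀ {n N} → n ℕ.≤′ N → qPochhammer j N n ≡ f j n
  go (ℕ.≤′-reflexive refl) = refl
  go {N = suc N} (ℕ.≤′-step n≤N) = trans
    (factor-below (qPochhammer j N)
      (ℕₚ.≤-trans (s≤s (ℕₚ.≤′⇒≤ n≤N)) (ℕₚ.m≤n*m (suc N) j)))
    (go n≤N)

lookup-quotient : ∀ A B n (i : Fin (suc n)) →
                  lookup (quotientCoeffs A B n) i ≡ (A ⊘ B) (n ∸ toℕ i)
lookup-quotient A B zero    zero    = refl
lookup-quotient A B (suc n) zero    = refl
lookup-quotient A B (suc n) (suc i) = lookup-quotient A B n i

⊘-correct : ∀ A B → B 0 ≡ 1ℤ → B ⊛ (A ⊘ B) ≗ A
⊘-correct A B B₀≡1 zero = begin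
  B 0 * A 0 + 0ℤ  ≡⟨ ℤₚ.+-identityʳ _ ⟩
  B 0 * A 0       ≡⟨ cong (_* A 0) B₀≡1 ⟩
  1ℤ * A 0        ≡⟨ ℤₚ.*-identityˡ _ ⟩
  A 0             ∎
  where open ≡-Reasoning
⊘-correct A B B₀≡1 (suc n) = begin
  B 0 * (A (suc n) - S) + T  ≡⟨ cong (λ b → b * (A (suc n) - S) + T) B₀≡1 ⟩
  1ℤ * (A (suc n) - S) + T   ≡⟨ cong₂ _+_ (ℤₚ.*-identityˡ (A (suc n) - S)) (sym S≡T) ⟩
  A (suc n) - S + S          ≡⟨ ℤₚ.+-assoc (A (suc n)) (- S) S ⟩
  A (suc n) + (- S + S)      ≡⟨ cong (A (suc n) +_) (ℤₚ.+-inverseˡ S) ⟩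
  A (suc n) + 0ℤ             ≡⟨ ℤₚ.+-identityʳ _ ⟩
  A (suc n)                  ∎
  where
  open ≡-Reasoning
  S T : ℤ
  S = ∑[ i ≤ n ] (B (suc (toℕ i)) * lookup (quotientCoeffs A B n) i)
  T = ∑[ i ≤ n ] (B (suc (toℕ i)) * (A ⊘ B) (n ∸ toℕ i))
  S≡T : S ≡ T
  S≡T = sum-cong-≗ (λ i → cong (B (suc (toℕ i)) *_) (lookup-quotient A B n i))

a-generating : f 4 ^ 3 ⊛ a-1²3²4⁻³ ≗ f 1 ^ 2 ⊛ f 3 ^ 2
a-generating = ⊘-correct (f 1 ^ 2 ⊛ f 3 ^ 2) (f 4 ^ 3) refl

{-# OPTIONS --safe #-}
module Submission where

-- With φ(q) = Σ_{k∈ℤ} q^{k²} and ψ(q) = Σ_{k∈ℤ} q^{2k²+k}, Gauss's products give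
-- f₁² f₃² = φ(-q) φ(-q³) f₂ f₆.  The odd part of φ(-q) φ(-q³) is -2q ψ(q²) ψ(q⁶), because
-- s² + 3t² with s ≢ t (mod 2) is (u² + 3v²)/4 with u ≡ v (mod 4) odd; the even part Ev is
-- supported on multiples of 4 and has coefficients ≥ 0.  Since ψ(q²) f₂ = f₄² and
-- ψ(q⁶) f₆ = f₁₂², this yields
--   f₁² f₃² / f₄³ = Ev f₂ f₆ / f₄³ - 2q f₁₂² / f₄.
-- Writing f₂ f₆ / f₄³ as a product of factors 1 - q^m with m ≡ 2 (mod 4) and of 1/(1 - q^m)
-- with 4 ∣ m, one of them (1 - q²)/(1 - q⁴) = 1/(1 + q²), shows that the first summand has
-- coefficients with the signs +, 0, -, 0, +, 0, -, 0, …  The second one is supported on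
-- exponents ≡ 1 (mod 4), and there it is negative by Cauchy's theorem
--   Σ_s (x;p)_s/(p;p)_s y^s = (p;p)_∞/(y;p)_∞,  xy = p,
-- at p = q¹², x = q⁸, y = q⁴, divided by (x;p)_∞.  Gauss's products come from partial sums of
-- the same series.

-- The change of variables is u = s + 3t, v = s - t, that is (s + t√-3)(1 - √-3) = u - v√-3, where 1
-- - √-3 has norm 4. Opposite parity of s and t makes v odd, and exactly one of (u, v), (-u, -v) has
-- u ≡ v ≡ 1 (mod 4). So each pair (4a + 1, 4b + 1) is counted twice, and (u² + 3v²)/4 = 1 + 2(2a² +
-- a) + 6(2b² + b) is an exponent of q ψ(q²) ψ(q⁶). Signs cannot be read off factor by factor while
-- f₁₂ stands in a numerator: 1 - q^(12k) violates both sign patterns. In f₂ f₆ / f₄³ it cancels, as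
-- f₄ = (q⁴;q¹²)_∞ (q⁸;q¹²)_∞ f₁₂. In f₁₂² / f₄ one f₁₂ survives this, and Cauchy's theorem removes
-- it: f₁₂ / ((q⁴;q¹²)_∞ (q⁸;q¹²)_∞) becomes Σ_s y^s / ((p;p)_s (x p^s;p)_∞), where every term has
-- coefficients ≥ 0. Strictness comes from comparison: each of the two series exceeds a known one,
-- 1/(1 + q²) or 1/(1 - q⁴), by a series with the same sign pattern.

open import Defs
open import Data.Integer.Base using (0ℤ; _<_; _>_)
open import Data.Nat.Base using (ℕ; _+_; _*_)
open import Data.Product.Base using (_×_)
open import Relation.Binary.PropositionalEquality using (_≡_)

open import Algebra.Bundles using (CommutativeRing)
import Algebra.Solver.Ring as RingSolver
open import Algebra.Solver.Ring.AlmostCommutativeRing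
  using (_-Raw-AlmostCommutative⟶_; fromCommutativeRing)
open import Data.Bool.Base using (if_then_else_)
open import Data.Fin.Base using (Fin; toℕ)
open import Data.Fin.Properties using (toℕ<n)
open import Data.Integer.Base as ℤ
  using (ℤ; 1ℤ; -1ℤ; +_; -[1+_]; _-_; -_; ∣_∣; +<+; -<+)
import Data.Integer.Properties as ℤₚ
import Data.Integer.Tactic.RingSolver as ℤSolver
open import Data.Maybe.Base using (just; nothing)
open import Data.Nat.Base as ℕ using (zero; suc; s≤s; z≤n)
import Data.Nat.Induction as ℕᵢ
import Data.Nat.Properties as ℕₚ
import Data.Nat.Tactic.RingSolver as ℕSolver
open import Data.Product.Base using (_,_; ∃-syntax; proj₂)
open import Data.Sum.Base using (_⊎_; inj₁; inj₂)
open import Function.Base using (_∘_)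
open import Relation.Binary.Definitions using (WeaklyDecidable)
open import Relation.Binary.PropositionalEquality
  using (_≢_; refl; sym; trans; cong; cong₂; subst; module ≡-Reasoning)
import Relation.Binary.Reasoning.Setoid as SetoidReasoning
open import Relation.Nullary.Decidable using (yes; no; does; dec-true; dec-false)
open import Algebra.Properties.Monoid.Sum ℤₚ.+-0-monoid using (sum; sum-cong-≗)

-- The ring of formal power series

-- Defs.Series is a function type, and Agda compares functions by applying them, which
-- unfolds _⊛_ and prevents inference; series are therefore wrapped in a record without η.
record PowerSeries : Set where
  no-eta-equality
  constructor series
  field coeff : Series
open PowerSeries

infix 4 _≈_
record _≈_ (A B : PowerSeries) : Set where
  constructor pointwise
  field at : ∀ n → coeff A n ≡ coeff B n
open _≈_

infixl 6 _+ₛ_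
infixl 7 _*ₛ_
infix  8 -ₛ_

0ₛ 1ₛ X : PowerSeries
coeff 0ₛ _ = 0ℤ
coeff 1ₛ   = 𝟙
coeff X    = q^ 1

_+ₛ_ _*ₛ_ : PowerSeries → PowerSeries → PowerSeries
coeff (A +ₛ B) n = coeff A n ℤ.+ coeff B n
coeff (A *ₛ B)   = coeff A ⊛ coeff B

-ₛ_ : PowerSeries → PowerSeries
coeff (-ₛ A) n = - coeff A n

constant : ℤ → PowerSeries
coeff (constant c) zero    = c
coeff (constant c) (suc _) = 0ℤ

shift : Series → Series
shift A n = A (suc n)

⊛-cong-upto : ∀ {A A′ B B′} n → (∀ i → i ℕ.≤ n → A i ≡ A′ i) →
              (∀ i → i ℕ.≤ n → B i ≡ B′ i) → (A ⊛ B) n ≡ (A′ ⊛ B′) n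
⊛-cong-upto n eA eB = sum-cong-≗ λ i →
  cong₂ ℤ._*_ (eA (toℕ i) (ℕₚ.≤-pred (toℕ<n i))) (eB _ (ℕₚ.m∸n≤m n (toℕ i)))

-- The first summand of a convolution splits off by computation, since `_⊛_` sums upwards from index
-- 0. Splitting off the last one as well makes the two ends symmetric, as commutativity requires.
⊛-sucʳ : ∀ A B n → (A ⊛ B) (suc n) ≡ (A ⊛ shift B) n ℤ.+ A (suc n) ℤ.* B 0
⊛-sucʳ A B zero    = ring (A 0 ℤ.* B 1) (A 1 ℤ.* B 0)
  where
  ring : ∀ x y → x ℤ.+ (y ℤ.+ 0ℤ) ≡ (x ℤ.+ 0ℤ) ℤ.+ y
  ring = ℤSolver.solve-∀
⊛-sucʳ A B (suc n) = trans
  (cong (λ z → A 0 ℤ.* B (suc (suc n)) ℤ.+ z) (⊛-sucʳ (shift A) B n))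
  (sym (ℤₚ.+-assoc (A 0 ℤ.* B (suc (suc n))) _ _))

⊛-comm : ∀ A B n → (A ⊛ B) n ≡ (B ⊛ A) n
⊛-comm A B zero    = cong (ℤ._+ 0ℤ) (ℤₚ.*-comm (A 0) (B 0))
⊛-comm A B (suc n) = begin
  A 0 ℤ.* B (suc n) ℤ.+ (shift A ⊛ B) n  ≡⟨ ℤₚ.+-comm (A 0 ℤ.* B (suc n)) _ ⟩
  (shift A ⊛ B) n ℤ.+ A 0 ℤ.* B (suc n)  ≡⟨ cong₂ ℤ._+_ (⊛-comm (shift A) B n) (ℤₚ.*-comm (A 0) _) ⟩
  (B ⊛ shift A) n ℤ.+ B (suc n) ℤ.* A 0  ≡⟨ ⊛-sucʳ B A n ⟨
  (B ⊛ A) (suc n)                        ∎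
  where open ≡-Reasoning

⊛-distribʳ-+ : ∀ C A B n → ((λ k → A k ℤ.+ B k) ⊛ C) n ≡ (A ⊛ C) n ℤ.+ (B ⊛ C) n
⊛-distribʳ-+ C A B zero = ring (A 0) (B 0) (C 0)
  where
  ring : ∀ x y z → (x ℤ.+ y) ℤ.* z ℤ.+ 0ℤ ≡ x ℤ.* z ℤ.+ 0ℤ ℤ.+ (y ℤ.* z ℤ.+ 0ℤ)
  ring = ℤSolver.solve-∀
⊛-distribʳ-+ C A B (suc n) = trans
  (cong (λ z → (A 0 ℤ.+ B 0) ℤ.* C (suc n) ℤ.+ z) (⊛-distribʳ-+ C (shift A) (shift B) n))
  (ring (A 0) (B 0) (C (suc n)) ((shift A ⊛ C) n) ((shift B ⊛ C) n))
  where
  ring : ∀ x y z s t →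
         (x ℤ.+ y) ℤ.* z ℤ.+ (s ℤ.+ t) ≡ x ℤ.* z ℤ.+ s ℤ.+ (y ℤ.* z ℤ.+ t)
  ring = ℤSolver.solve-∀

⊛-scaleˡ : ∀ c A B n → ((λ k → c ℤ.* A k) ⊛ B) n ≡ c ℤ.* (A ⊛ B) n
⊛-scaleˡ c A B zero = ring c (A 0) (B 0)
  where
  ring : ∀ x y z → x ℤ.* y ℤ.* z ℤ.+ 0ℤ ≡ x ℤ.* (y ℤ.* z ℤ.+ 0ℤ)
  ring = ℤSolver.solve-∀
⊛-scaleˡ c A B (suc n) = trans
  (cong (λ z → c ℤ.* A 0 ℤ.* B (suc n) ℤ.+ z) (⊛-scaleˡ c (shift A) B n))
  (ring c (A 0) (B (suc n)) ((shift A ⊛ B) n))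
  where
  ring : ∀ x y z t → x ℤ.* y ℤ.* z ℤ.+ x ℤ.* t ≡ x ℤ.* (y ℤ.* z ℤ.+ t)
  ring = ℤSolver.solve-∀

⊛-assoc : ∀ A B C n → ((A ⊛ B) ⊛ C) n ≡ (A ⊛ (B ⊛ C)) n
⊛-assoc A B C zero = ring (A 0) (B 0) (C 0)
  where
  ring : ∀ x y z → (x ℤ.* y ℤ.+ 0ℤ) ℤ.* z ℤ.+ 0ℤ ≡ x ℤ.* (y ℤ.* z ℤ.+ 0ℤ) ℤ.+ 0ℤ
  ring = ℤSolver.solve-∀
⊛-assoc A B C (suc n) = begin
  (A 0 ℤ.* B 0 ℤ.+ 0ℤ) ℤ.* C (suc n) ℤ.+ (shift (A ⊛ B) ⊛ C) n
    ≡⟨ cong (λ z → (A 0 ℤ.* B 0 ℤ.+ 0ℤ) ℤ.* C (suc n) ℤ.+ z) (begin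
         (shift (A ⊛ B) ⊛ C) n
           ≡⟨ ⊛-distribʳ-+ C (λ k → A 0 ℤ.* B (suc k)) (shift A ⊛ B) n ⟩
         ((λ k → A 0 ℤ.* B (suc k)) ⊛ C) n ℤ.+ ((shift A ⊛ B) ⊛ C) n
           ≡⟨ cong₂ ℤ._+_ (⊛-scaleˡ (A 0) (shift B) C n) (⊛-assoc (shift A) B C n) ⟩
         A 0 ℤ.* (shift B ⊛ C) n ℤ.+ (shift A ⊛ (B ⊛ C)) n  ∎) ⟩
  _ ≡⟨ ring (A 0) (B 0) (C (suc n)) ((shift B ⊛ C) n) ((shift A ⊛ (B ⊛ C)) n) ⟩
  (A ⊛ (B ⊛ C)) (suc n) ∎
  where
  open ≡-Reasoning
  ring : ∀ x y z s t → (x ℤ.* y ℤ.+ 0ℤ) ℤ.* z ℤ.+ (x ℤ.* s ℤ.+ t) ≡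
                       x ℤ.* (y ℤ.* z ℤ.+ s) ℤ.+ t
  ring = ℤSolver.solve-∀

⊛-zeroˡ : ∀ B n → ((λ _ → 0ℤ) ⊛ B) n ≡ 0ℤ
⊛-zeroˡ B n = sum-zero {suc n} _ λ i → ℤₚ.*-zeroˡ (B (n ℕ.∸ toℕ i))

constant-⊛ : ∀ c A n → (coeff (constant c) ⊛ A) n ≡ c ℤ.* A n
constant-⊛ c A zero    = ℤₚ.+-identityʳ _
constant-⊛ c A (suc n) = trans (cong (λ z → c ℤ.* A (suc n) ℤ.+ z) (⊛-zeroˡ A n)) (ℤₚ.+-identityʳ _)

1≈constant : 1ₛ ≈ constant 1ℤ
1≈constant = pointwise λ { zero → refl ; (suc _) → refl }

*ₛ-cong : ∀ {A A′ B B′} → A ≈ A′ → B ≈ B′ → A *ₛ B ≈ A′ *ₛ B′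
*ₛ-cong eA eB = pointwise λ n → ⊛-cong-upto n (λ i _ → at eA i) (λ i _ → at eB i)

*ₛ-comm : ∀ A B → A *ₛ B ≈ B *ₛ A
*ₛ-comm A B = pointwise (⊛-comm (coeff A) (coeff B))

constant-* : ∀ c d → constant c *ₛ constant d ≈ constant (c ℤ.* d)
constant-* c d = pointwise λ
  { zero    → constant-⊛ c (coeff (constant d)) 0
  ; (suc n) → trans (constant-⊛ c (coeff (constant d)) (suc n)) (ℤₚ.*-zeroʳ c) }

seriesRing : CommutativeRing _ _
seriesRing = record
  { Carrier = PowerSeries ; _≈_ = _≈_ ; _+_ = _+ₛ_ ; _*_ = _*ₛ_ ; -_ = -ₛ_ ; 0# = 0ₛ ; 1# = 1ₛ
  ; isCommutativeRing = record
    { isRing = record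
      { +-isAbelianGroup = record
        { isGroup = record
          { isMonoid = record
            { isSemigroup = record
              { isMagma = record
                { isEquivalence = record
                  { refl = pointwise λ _ → refl ; sym = ≈-sym ; trans = ≈-trans }
                ; ∙-cong = λ e e′ → pointwise λ n → cong₂ ℤ._+_ (at e n) (at e′ n)
                }
              ; assoc = λ A B C → pointwise λ n → ℤₚ.+-assoc (coeff A n) (coeff B n) (coeff C n)
              }
            ; identity = (λ A → pointwise λ n → ℤₚ.+-identityˡ (coeff A n))
                       , (λ A → pointwise λ n → ℤₚ.+-identityʳ (coeff A n))
            }
          ; inverse = (λ A → pointwise λ n → ℤₚ.+-inverseˡ (coeff A n))
                    , (λ A → pointwise λ n → ℤₚ.+-inverseʳ (coeff A n))
          ; ⁻¹-cong = λ e → pointwise λ n → cong -_ (at e n)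
          }
        ; comm = λ A B → pointwise λ n → ℤₚ.+-comm (coeff A n) (coeff B n)
        }
      ; *-cong = *ₛ-cong
      ; *-assoc = λ A B C → pointwise (⊛-assoc (coeff A) (coeff B) (coeff C))
      ; *-identity = identityˡ , (λ A → ≈-trans (*ₛ-comm A 1ₛ) (identityˡ A))
      ; distrib = (λ C A B → ≈-trans (*ₛ-comm C (A +ₛ B)) (≈-trans (distribʳ C A B)
                    (pointwise λ n → cong₂ ℤ._+_ (at (*ₛ-comm A C) n) (at (*ₛ-comm B C) n))))
                , distribʳ
      }
    ; *-comm = *ₛ-comm
    }
  }
  where
  ≈-sym : ∀ {A B} → A ≈ B → B ≈ A
  ≈-sym (pointwise e) = pointwise λ n → sym (e n)
  ≈-trans : ∀ {A B C} → A ≈ B → B ≈ C → A ≈ C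
  ≈-trans (pointwise e) (pointwise e′) = pointwise λ n → trans (e n) (e′ n)
  identityˡ : ∀ A → 1ₛ *ₛ A ≈ A
  identityˡ A = ≈-trans (*ₛ-cong {B = A} {A} 1≈constant (pointwise λ _ → refl))
    (pointwise λ n → trans (constant-⊛ 1ℤ (coeff A) n) (ℤₚ.*-identityˡ (coeff A n)))
  distribʳ : ∀ C A B → (A +ₛ B) *ₛ C ≈ A *ₛ C +ₛ B *ₛ C
  distribʳ C A B = pointwise (⊛-distribʳ-+ (coeff C) (coeff A) (coeff B))

open CommutativeRing seriesRing
  using (setoid; zeroˡ; zeroʳ; distribˡ; distribʳ)
  renaming
  ( refl to ≈-refl; sym to ≈-sym; trans to ≈-trans; _-_ to _-ₛ_
  ; +-cong to +ₛ-cong; +-congˡ to +ₛ-congˡ; +-congʳ to +ₛ-congʳ; -‿cong to -ₛ-cong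
  ; +-identityˡ to +ₛ-identityˡ; +-identityʳ to +ₛ-identityʳ
  ; *-congˡ to *ₛ-congˡ; *-congʳ to *ₛ-congʳ; *-assoc to *ₛ-assoc
  ; *-identityˡ to *ₛ-identityˡ; *-identityʳ to *ₛ-identityʳ )

open import Algebra.Properties.Semiring.Exp (CommutativeRing.semiring seriesRing)
  using (^-congˡ; ^-homo-*; ^-assocʳ) renaming (_^_ to _^ₛ_)
open import Algebra.Properties.CommutativeSemiring.Exp
  (CommutativeRing.commutativeSemiring seriesRing) using (^-distrib-*)

module ≈-Reasoning = SetoidReasoning setoid

-ₛ-cong₂ : ∀ {A A′ B B′} → A ≈ A′ → B ≈ B′ → A -ₛ B ≈ A′ -ₛ B′
-ₛ-cong₂ e e′ = +ₛ-cong e (-ₛ-cong e′)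

module Solver where
  -- The solver's literals 0 and 1 have to be 0ₛ and 1ₛ themselves.
  embed : ℤ → PowerSeries
  embed (+ 0) = 0ₛ
  embed (+ 1) = 1ₛ
  embed c     = constant c

  embed≈constant : ∀ c → embed c ≈ constant c
  embed≈constant (+ 0)           = pointwise λ { zero → refl ; (suc _) → refl }
  embed≈constant (+ 1)           = 1≈constant
  embed≈constant (+ suc (suc _)) = ≈-refl
  embed≈constant -[1+ _ ]        = ≈-refl

  embedding : ℤ.+-*-rawRing -Raw-AlmostCommutative⟶ fromCommutativeRing seriesRing
  embedding = record
    { ⟦_⟧    = embed
    ; +-homo = λ c d → begin
        embed (c ℤ.+ d)           ≈⟨ embed≈constant (c ℤ.+ d) ⟩
        constant (c ℤ.+ d)        ≈⟨ pointwise (λ { zero → refl ; (suc _) → refl }) ⟩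
        constant c +ₛ constant d  ≈⟨ +ₛ-cong (embed≈constant c) (embed≈constant d) ⟨
        embed c +ₛ embed d        ∎
    ; *-homo = λ c d → begin
        embed (c ℤ.* d)           ≈⟨ embed≈constant (c ℤ.* d) ⟩
        constant (c ℤ.* d)        ≈⟨ constant-* c d ⟨
        constant c *ₛ constant d  ≈⟨ *ₛ-cong (embed≈constant c) (embed≈constant d) ⟨
        embed c *ₛ embed d        ∎
    ; -‿homo = λ c → begin
        embed (- c)      ≈⟨ embed≈constant (- c) ⟩
        constant (- c)   ≈⟨ pointwise (λ { zero → refl ; (suc _) → refl }) ⟩
        -ₛ constant c    ≈⟨ -ₛ-cong (embed≈constant c) ⟨
        -ₛ embed c       ∎
    ; 0-homo = ≈-refl
    ; 1-homo = ≈-refl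
    }
    where open ≈-Reasoning

  embed≟ : WeaklyDecidable (λ c d → embed c ≈ embed d)
  embed≟ c d with c ℤₚ.≟ d
  ... | yes refl = just ≈-refl
  ... | no  _    = nothing

  open RingSolver ℤ.+-*-rawRing (fromCommutativeRing seriesRing)
    embedding embed≟ public

  :0 :1 : ∀ {n} → Polynomial n
  :0 = con 0ℤ
  :1 = con 1ℤ

-- Congruence of series modulo qᴺ, and inverses

infix 4 _≈[_]_
record _≈[_]_ (A : PowerSeries) (N : ℕ) (B : PowerSeries) : Set where
  constructor below
  field at-below : ∀ {n} → n ℕ.< N → coeff A n ≡ coeff B n
open _≈[_]_

≈⇒≈[] : ∀ {A B N} → A ≈ B → A ≈[ N ] B
≈⇒≈[] e = below λ _ → at e _

≈[]⇒≈ : ∀ {A B} → (∀ N → A ≈[ N ] B) → A ≈ B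
≈[]⇒≈ e = pointwise λ n → at-below (e (suc n)) (ℕₚ.n<1+n n)

≈[]-sym : ∀ {A B N} → A ≈[ N ] B → B ≈[ N ] A
≈[]-sym (below e) = below λ n<N → sym (e n<N)

≈[]-trans : ∀ {A B C N} → A ≈[ N ] B → B ≈[ N ] C → A ≈[ N ] C
≈[]-trans (below e) (below e′) = below λ n<N → trans (e n<N) (e′ n<N)

≈[]-weaken : ∀ {A B M N} → M ℕ.≤ N → A ≈[ N ] B → A ≈[ M ] B
≈[]-weaken M≤N (below e) = below λ n<M → e (ℕₚ.<-≤-trans n<M M≤N)

≈[]-refl : ∀ {A N} → A ≈[ N ] A
≈[]-refl = below λ _ → refl

+ₛ-cong[] : ∀ {A A′ B B′ N} → A ≈[ N ] A′ → B ≈[ N ] B′ → A +ₛ B ≈[ N ] A′ +ₛ B′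
+ₛ-cong[] (below e) (below e′) = below λ n<N → cong₂ ℤ._+_ (e n<N) (e′ n<N)

-ₛ-cong[] : ∀ {A A′ N} → A ≈[ N ] A′ → -ₛ A ≈[ N ] -ₛ A′
-ₛ-cong[] (below e) = below λ n<N → cong -_ (e n<N)

*ₛ-cong[] : ∀ {A A′ B B′ N} → A ≈[ N ] A′ → B ≈[ N ] B′ → A *ₛ B ≈[ N ] A′ *ₛ B′
*ₛ-cong[] (below e) (below e′) = below λ {n} n<N →
  ⊛-cong-upto n (λ i i≤n → e (ℕₚ.≤-<-trans i≤n n<N)) (λ i i≤n → e′ (ℕₚ.≤-<-trans i≤n n<N))

*ₛ-zeroˡ[] : ∀ {A N} B → A ≈[ N ] 0ₛ → A *ₛ B ≈[ N ] 0ₛ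
*ₛ-zeroˡ[] B e = ≈[]-trans (*ₛ-cong[] e ≈[]-refl) (≈⇒≈[] (zeroˡ B))

*ₛ-zeroʳ[] : ∀ {B N} A → B ≈[ N ] 0ₛ → A *ₛ B ≈[ N ] 0ₛ
*ₛ-zeroʳ[] A e = ≈[]-trans (*ₛ-cong[] ≈[]-refl e) (≈⇒≈[] (zeroʳ A))

-- Without constant term, `A` is q times `shift (coeff A)`, so coefficient n + 1 of the product is
-- coefficient n of that shift times `B`.
*ₛ-order-suc : ∀ {A B N} → coeff A 0 ≡ 0ℤ → B ≈[ N ] 0ₛ → A *ₛ B ≈[ suc N ] 0ₛ
*ₛ-order-suc {A} {B} A₀≡0 e = below λ
  { {zero}  _         → cong (λ z → z ℤ.* coeff B 0 ℤ.+ 0ℤ) A₀≡0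
  ; {suc n} (s≤s n<N) → cong₂ ℤ._+_ (cong (ℤ._* coeff B (suc n)) A₀≡0)
                          (at-below (*ₛ-zeroʳ[] (series (shift (coeff A))) e) n<N) }

^ₛ-order : ∀ {A} N → coeff A 0 ≡ 0ℤ → A ^ₛ N ≈[ N ] 0ₛ
^ₛ-order zero    A₀≡0 = below λ ()
^ₛ-order (suc N) A₀≡0 = *ₛ-order-suc A₀≡0 (^ₛ-order N A₀≡0)

coeff-*₀ : ∀ {A B} → coeff A 0 ≡ 1ℤ → coeff B 0 ≡ 1ℤ → coeff (A *ₛ B) 0 ≡ 1ℤ
coeff-*₀ A₀≡1 B₀≡1 = cong₂ (λ x y → x ℤ.* y ℤ.+ 0ℤ) A₀≡1 B₀≡1

inv : PowerSeries → PowerSeries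
coeff (inv A) = 𝟙 ⊘ coeff A

*ₛ-inverseʳ : ∀ A → coeff A 0 ≡ 1ℤ → A *ₛ inv A ≈ 1ₛ
*ₛ-inverseʳ A A₀≡1 = pointwise (⊘-correct 𝟙 (coeff A) A₀≡1)

*ₛ-cancelˡ[] : ∀ {A B B′ N} → coeff A 0 ≡ 1ℤ → A *ₛ B ≈[ N ] A *ₛ B′ → B ≈[ N ] B′
*ₛ-cancelˡ[] {A} {B} {B′} A₀≡1 e =
  ≈[]-trans (≈⇒≈[] (≈-sym (undo B))) (≈[]-trans (*ₛ-cong[] ≈[]-refl e) (≈⇒≈[] (undo B′)))
  where
  undo : ∀ B → inv A *ₛ (A *ₛ B) ≈ B
  undo B = begin
    inv A *ₛ (A *ₛ B)  ≈⟨ solve 3 (λ a i b → i :* (a :* b) := a :* i :* b) ≈-refl A (inv A) B ⟩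
    A *ₛ inv A *ₛ B    ≈⟨ *ₛ-congʳ (*ₛ-inverseʳ A A₀≡1) ⟩
    1ₛ *ₛ B            ≈⟨ *ₛ-identityˡ B ⟩
    B                  ∎
    where
    open Solver
    open ≈-Reasoning

*ₛ-cancelˡ : ∀ {A B B′} → coeff A 0 ≡ 1ℤ → A *ₛ B ≈ A *ₛ B′ → B ≈ B′
*ₛ-cancelˡ A₀≡1 e = ≈[]⇒≈ λ N → *ₛ-cancelˡ[] A₀≡1 (≈⇒≈[] e)

inv-unital : ∀ {A N} → coeff A 0 ≡ 1ℤ → A ≈[ N ] 1ₛ → inv A ≈[ N ] 1ₛ
inv-unital {A} A₀≡1 e = *ₛ-cancelˡ[] A₀≡1
  (≈[]-trans (≈⇒≈[] (*ₛ-inverseʳ A A₀≡1))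
  (≈[]-trans (≈[]-sym e) (≈⇒≈[] (≈-sym (*ₛ-identityʳ A)))))

coeff-X* : ∀ A n → coeff (X *ₛ A) (suc n) ≡ coeff A n
coeff-X* A n = trans (ℤₚ.+-identityˡ _) (at (*ₛ-identityˡ A) n)

coeff-X^ : ∀ m n → coeff (X ^ₛ m) n ≡ q^ m n
coeff-X^ zero    n       = refl
coeff-X^ (suc m) zero    = refl
coeff-X^ (suc m) (suc n) = trans (coeff-X* (X ^ₛ m) n) (coeff-X^ m n)

-- Infinite products

Π : (ℕ → PowerSeries) → ℕ → PowerSeries
Π u zero    = 1ₛ
Π u (suc N) = u N *ₛ Π u N

-- This rate of convergence fixes coefficient n of the product after the factors 0, ..., n - 1,
-- which is where `Π∞` reads it.
Unital : (ℕ → PowerSeries) → Set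
Unital u = ∀ k → u k ≈[ suc k ] 1ₛ

Π∞ : (ℕ → PowerSeries) → PowerSeries
coeff (Π∞ u) n = coeff (Π u n) n

Π-cong : ∀ {u v} → (∀ k → u k ≈ v k) → ∀ N → Π u N ≈ Π v N
Π-cong e zero    = ≈-refl
Π-cong e (suc N) = *ₛ-cong (e N) (Π-cong e N)

Π∞-cong : ∀ {u v} → (∀ k → u k ≈ v k) → Π∞ u ≈ Π∞ v
Π∞-cong e = pointwise λ n → at (Π-cong e n) n

Π-limit : ∀ {u} → Unital u → ∀ N → Π u N ≈[ suc N ] Π∞ u
Π-limit {u} unital N = below λ { (s≤s n≤N) → go (ℕₚ.≤⇒≤′ n≤N) }
  where
  go : ∀ {n N} → n ℕ.≤′ N → coeff (Π u N) n ≡ coeff (Π u n) n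
  go (ℕ.≤′-reflexive refl) = refl
  go {n} {suc N} (ℕ.≤′-step n≤N) = trans
    (at-below (*ₛ-cong[] {B = Π u N} (unital N) ≈[]-refl) (s≤s (ℕₚ.≤′⇒≤ n≤N)))
    (trans (at (*ₛ-identityˡ (Π u N)) n) (go n≤N))

Unital-* : ∀ {u v} → Unital u → Unital v → Unital (λ k → u k *ₛ v k)
Unital-* u₁ v₁ k = ≈[]-trans (*ₛ-cong[] (u₁ k) (v₁ k)) (≈⇒≈[] (*ₛ-identityˡ 1ₛ))

Π-* : ∀ u v N → Π (λ k → u k *ₛ v k) N ≈ Π u N *ₛ Π v N
Π-* u v zero    = ≈-sym (*ₛ-identityˡ 1ₛ)
Π-* u v (suc N) = ≈-trans (*ₛ-congˡ (Π-* u v N))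
  (solve 4 (λ a b c d → a :* b :* (c :* d) := a :* c :* (b :* d)) ≈-refl (u N) (v N) (Π u N) (Π v N))
  where open Solver

Π∞-* : ∀ {u v} → Unital u → Unital v → Π∞ (λ k → u k *ₛ v k) ≈ Π∞ u *ₛ Π∞ v
Π∞-* {u} {v} u₁ v₁ = pointwise λ n → trans (at (Π-* u v n) n)
  (at-below (*ₛ-cong[] (Π-limit u₁ n) (Π-limit v₁ n)) (ℕₚ.n<1+n n))

-- Meant for `v k` a product of m consecutive factors of `u`, to sort an Euler product by residues
-- modulo m: n blocks contain m n ≥ n factors, enough for coefficient n.
Π∞-blocks : ∀ {u v} m .{{_ : ℕ.NonZero m}} → Unital u →
            (∀ N → Π v N ≈ Π u (m ℕ.* N)) → Π∞ v ≈ Π∞ u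
Π∞-blocks m u₁ e = pointwise λ n → trans (at (e n) n)
  (at-below (Π-limit u₁ (m ℕ.* n)) (s≤s (ℕₚ.m≤n*m n m)))

Π-head : ∀ u N → Π u (suc N) ≈ u 0 *ₛ Π (u ∘ suc) N
Π-head u zero    = ≈-refl
Π-head u (suc N) = ≈-trans (*ₛ-congˡ (Π-head u N))
  (solve 3 (λ a b c → a :* (b :* c) := b :* (a :* c)) ≈-refl (u (suc N)) (u 0) (Π (u ∘ suc) N))
  where open Solver

Unital-tail : ∀ {u} → Unital u → Unital (u ∘ suc)
Unital-tail u₁ k = ≈[]-weaken (ℕₚ.n≤1+n (suc k)) (u₁ (suc k))

Π∞-head : ∀ {u} → Unital u → Π∞ u ≈ u 0 *ₛ Π∞ (u ∘ suc)
Π∞-head {u} u₁ = pointwise λ n → begin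
  coeff (Π∞ u) n                     ≡⟨ at-below (Π-limit u₁ (suc n)) (s≤s (ℕₚ.n≤1+n n)) ⟨
  coeff (Π u (suc n)) n              ≡⟨ at (Π-head u n) n ⟩
  coeff (u 0 *ₛ Π (u ∘ suc) n) n     ≡⟨ at-below (*ₛ-cong[] {A = u 0} ≈[]-refl
                                          (Π-limit (Unital-tail u₁) n)) (ℕₚ.n<1+n n) ⟩
  coeff (u 0 *ₛ Π∞ (u ∘ suc)) n      ∎
  where open ≡-Reasoning

Π-1 : ∀ N → Π (λ _ → 1ₛ) N ≈ 1ₛ
Π-1 zero    = ≈-refl
Π-1 (suc N) = ≈-trans (*ₛ-identityˡ _) (Π-1 N)

Unital₀ : ∀ {u} → Unital u → ∀ k → coeff (u k) 0 ≡ 1ℤ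
Unital₀ u₁ k = at-below (u₁ k) (s≤s z≤n)

Unital-inv : ∀ {u} → Unital u → Unital (inv ∘ u)
Unital-inv u₁ k = inv-unital (Unital₀ u₁ k) (u₁ k)

Π∞-inv : ∀ {u} → Unital u → Π∞ u *ₛ Π∞ (inv ∘ u) ≈ 1ₛ
Π∞-inv {u} u₁ = begin
  Π∞ u *ₛ Π∞ (inv ∘ u)         ≈⟨ Π∞-* u₁ (Unital-inv u₁) ⟨
  Π∞ (λ k → u k *ₛ inv (u k))  ≈⟨ Π∞-cong (λ k → *ₛ-inverseʳ (u k) (Unital₀ u₁ k)) ⟩
  Π∞ (λ _ → 1ₛ)                ≈⟨ pointwise (λ n → at (Π-1 n) n) ⟩
  1ₛ                           ∎
  where open ≈-Reasoning

-- Cones of series with prescribed signs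

module Cone (χ : ℕ → ℤ) (χ₀≡1 : χ 0 ≡ 1ℤ)
            (χ-* : ∀ i j → ∃[ e ] χ i ℤ.* χ j ≡ χ (i ℕ.+ j) ℤ.* + e) where

  -- A natural multiple of `χ n` has the sign of `χ n`, and is 0 where `χ n` is. A character would
  -- satisfy `χ-*` with e = 1; the general e allows zeros of `χ`, as i and j may be zeros while i +
  -- j is not, and then e = 0.
  record Graded (n : ℕ) (z : ℤ) : Set where
    constructor multiple
    field
      factor   : ℕ
      equation : z ≡ χ n ℤ.* + factor

  record InCone (A : PowerSeries) : Set where
    constructor inCone
    field graded : ∀ n → Graded n (coeff A n)
  open InCone public

  record Strict (A : PowerSeries) : Set where
    constructor mkStrict
    field strict : ∀ n → ∃[ b ] coeff A n ≡ χ n ℤ.* + suc b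
  open Strict public

  graded-0 : ∀ n → Graded n 0ℤ
  graded-0 n = multiple 0 (sym (ℤₚ.*-zeroʳ (χ n)))

  graded-+ : ∀ {n x y} → Graded n x → Graded n y → Graded n (x ℤ.+ y)
  graded-+ {n} (multiple b refl) (multiple c refl) = multiple (b ℕ.+ c) (begin
    χ n ℤ.* + b ℤ.+ χ n ℤ.* + c  ≡⟨ ℤₚ.*-distribˡ-+ (χ n) (+ b) (+ c) ⟨
    χ n ℤ.* (+ b ℤ.+ + c)        ≡⟨ cong (χ n ℤ.*_) (ℤₚ.pos-+ b c) ⟨
    χ n ℤ.* + (b ℕ.+ c)          ∎)
    where open ≡-Reasoning

  graded-* : ∀ {i j x y} → Graded i x → Graded j y → Graded (i ℕ.+ j) (x ℤ.* y)
  graded-* {i} {j} (multiple b refl) (multiple c refl) with e , χχ ← χ-* i j = multiple (e ℕ.* (b ℕ.* c)) (begin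
    χ i ℤ.* + b ℤ.* (χ j ℤ.* + c)           ≡⟨ regroup (χ i) (+ b) (χ j) (+ c) ⟩
    χ i ℤ.* χ j ℤ.* (+ b ℤ.* + c)           ≡⟨ cong₂ ℤ._*_ χχ (sym (ℤₚ.pos-* b c)) ⟩
    χ (i ℕ.+ j) ℤ.* + e ℤ.* + (b ℕ.* c)     ≡⟨ ℤₚ.*-assoc (χ (i ℕ.+ j)) (+ e) _ ⟩
    χ (i ℕ.+ j) ℤ.* (+ e ℤ.* + (b ℕ.* c))   ≡⟨ cong (χ (i ℕ.+ j) ℤ.*_) (ℤₚ.pos-* e (b ℕ.* c)) ⟨
    χ (i ℕ.+ j) ℤ.* + (e ℕ.* (b ℕ.* c))     ∎)
    where
    open ≡-Reasoning
    regroup : ∀ x y z t → x ℤ.* y ℤ.* (z ℤ.* t) ≡ x ℤ.* z ℤ.* (y ℤ.* t)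
    regroup = ℤSolver.solve-∀

  graded-sum : ∀ {n m} (t : Fin m → ℤ) → (∀ i → Graded n (t i)) → Graded n (sum t)
  graded-sum {m = zero}  t t∈ = graded-0 _
  graded-sum {m = suc m} t t∈ = graded-+ (t∈ Fin.zero) (graded-sum (t ∘ Fin.suc) (t∈ ∘ Fin.suc))

  -- The offset d is 1 in `cone-inv`, where the first factor is a shifted series, whose coefficient
  -- i has the grade of i + 1.
  graded-⊛ : ∀ {A B} d n → (∀ {i} → i ℕ.≤ n → Graded (d ℕ.+ i) (A i)) →
             (∀ {i} → i ℕ.≤ n → Graded i (B i)) → Graded (d ℕ.+ n) ((A ⊛ B) n)
  graded-⊛ {A} {B} d n A∈ B∈ = graded-sum _ λ i →
    let i≤n = ℕₚ.≤-pred (toℕ<n i) in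
    subst (λ m → Graded m (A (toℕ i) ℤ.* B (n ℕ.∸ toℕ i)))
      (trans (ℕₚ.+-assoc d (toℕ i) _) (cong (d ℕ.+_) (ℕₚ.m+[n∸m]≡n i≤n)))
      (graded-* (A∈ i≤n) (B∈ (ℕₚ.m∸n≤m n (toℕ i))))

  cone-≈ : ∀ {A B} → A ≈ B → InCone A → InCone B
  cone-≈ e A∈ = inCone λ n → subst (Graded n) (at e n) (graded A∈ n)

  cone-1 : InCone 1ₛ
  cone-1 = inCone λ
    { zero    → multiple 1 (cong (ℤ._* 1ℤ) (sym χ₀≡1))
    ; (suc n) → graded-0 (suc n) }

  cone-+ : ∀ {A B} → InCone A → InCone B → InCone (A +ₛ B)
  cone-+ A∈ B∈ = inCone λ n → graded-+ (graded A∈ n) (graded B∈ n)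

  cone-* : ∀ {A B} → InCone A → InCone B → InCone (A *ₛ B)
  cone-* A∈ B∈ = inCone λ n → graded-⊛ 0 n (λ {i} _ → graded A∈ i) (λ {i} _ → graded B∈ i)

  cone-^ : ∀ {A} n → InCone A → InCone (A ^ₛ n)
  cone-^ zero    A∈ = cone-1
  cone-^ (suc n) A∈ = cone-* A∈ (cone-^ n A∈)

  cone-Π : ∀ {u} → (∀ k → InCone (u k)) → ∀ N → InCone (Π u N)
  cone-Π u∈ zero    = cone-1
  cone-Π u∈ (suc N) = cone-* (u∈ N) (cone-Π u∈ N)

  cone-Π∞ : ∀ {u} → (∀ k → InCone (u k)) → InCone (Π∞ u)
  cone-Π∞ u∈ = inCone λ n → graded (cone-Π u∈ n) n

  -- The inverse satisfies B = 1 + C B. As C has no constant term, coefficient n + 1 of C B involves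
  -- B only up to n, and strong induction applies.
  cone-inv : ∀ {C} → coeff C 0 ≡ 0ℤ → InCone C → InCone (inv (1ₛ -ₛ C))
  cone-inv {C} C₀≡0 C∈ = inCone (ℕᵢ.<-rec _ step)
    where
    A = 1ₛ -ₛ C
    B = inv A
    fixpoint : B ≈ 1ₛ +ₛ C *ₛ B
    fixpoint = begin
      B                               ≈⟨ solve 2 (λ c b → b := (:1 :- c) :* b :+ c :* b) ≈-refl C B ⟩
      A *ₛ B +ₛ C *ₛ B                ≈⟨ +ₛ-congʳ (*ₛ-inverseʳ A (cong (λ z → 1ℤ ℤ.+ - z) C₀≡0)) ⟩
      1ₛ +ₛ C *ₛ B                    ∎
      where
      open Solver
      open ≈-Reasoning
    step : ∀ n → (∀ {m} → m ℕ.< n → Graded m (coeff B m)) → Graded n (coeff B n)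
    step zero    rec = graded cone-1 0
    step (suc n) rec = subst (Graded (suc n)) (sym (begin
      coeff B (suc n)                                          ≡⟨ at fixpoint (suc n) ⟩
      0ℤ ℤ.+ (coeff C 0 ℤ.* coeff B (suc n) ℤ.+ (shift (coeff C) ⊛ coeff B) n)
        ≡⟨ cong (λ z → 0ℤ ℤ.+ (z ℤ.* coeff B (suc n) ℤ.+ (shift (coeff C) ⊛ coeff B) n)) C₀≡0 ⟩
      0ℤ ℤ.+ (0ℤ ℤ.+ (shift (coeff C) ⊛ coeff B) n)            ≡⟨ ℤₚ.+-identityˡ _ ⟩
      0ℤ ℤ.+ (shift (coeff C) ⊛ coeff B) n                     ≡⟨ ℤₚ.+-identityˡ _ ⟩
      (shift (coeff C) ⊛ coeff B) n                            ∎))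
      (graded-⊛ 1 n (λ {i} _ → graded C∈ (suc i)) (λ i≤n → rec (s≤s i≤n)))
      where open ≡-Reasoning

  cone-monomial : ∀ m → InCone (constant (χ m) *ₛ X ^ₛ m)
  cone-monomial m = inCone λ n → subst (Graded n)
    (sym (trans (constant-⊛ (χ m) (coeff (X ^ₛ m)) n) (cong (χ m ℤ.*_) (coeff-X^ m n))))
    (go n)
    where
    go : ∀ n → Graded n (χ m ℤ.* q^ m n)
    go n with n ℕₚ.≟ m
    ... | yes refl rewrite dec-true (m ℕₚ.≟ m) refl = multiple 1 refl
    ... | no n≢m rewrite dec-false (n ℕₚ.≟ m) n≢m =
      multiple 0 (trans (ℤₚ.*-zeroʳ (χ m)) (sym (ℤₚ.*-zeroʳ (χ n))))

  cone-X^ : ∀ m → χ m ≡ 1ℤ → InCone (X ^ₛ m)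
  cone-X^ m χ≡1 = cone-≈ (pointwise λ n → trans (constant-⊛ (χ m) (coeff (X ^ₛ m)) n)
    (trans (cong (ℤ._* coeff (X ^ₛ m) n) χ≡1) (ℤₚ.*-identityˡ _))) (cone-monomial m)

  cone--X^ : ∀ m → χ m ≡ -1ℤ → InCone (-ₛ X ^ₛ m)
  cone--X^ m χ≡-1 = cone-≈ (pointwise λ n → trans (constant-⊛ (χ m) (coeff (X ^ₛ m)) n)
    (trans (cong (ℤ._* coeff (X ^ₛ m) n) χ≡-1) (ℤₚ.-1*i≡-i _))) (cone-monomial m)

  cone-minus-1 : ∀ {A} → InCone A → coeff A 0 ≡ 1ℤ → InCone (A -ₛ 1ₛ)
  cone-minus-1 A∈ A₀≡1 = inCone λ
    { zero    → subst (λ z → Graded 0 (z ℤ.- 1ℤ)) (sym A₀≡1) (graded-0 0)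
    ; (suc n) → subst (Graded (suc n)) (sym (ℤₚ.+-identityʳ _)) (graded A∈ (suc n)) }

  strict⇒cone : ∀ {A} → Strict A → InCone A
  strict⇒cone A> = inCone λ n → let b , e = strict A> n in multiple (suc b) e

  strict-≈ : ∀ {A B} → A ≈ B → Strict A → Strict B
  strict-≈ e A> = mkStrict λ n → let b , e′ = strict A> n in b , trans (sym (at e n)) e′

  strict-+ : ∀ {A B} → Strict A → InCone B → Strict (A +ₛ B)
  strict-+ A> B∈ = mkStrict λ n → let b , e = strict A> n ; multiple c e′ = graded B∈ n in
    b ℕ.+ c , trans (cong₂ ℤ._+_ e e′) (sym (trans (cong (χ n ℤ.*_) (ℤₚ.pos-+ (suc b) c))
      (ℤₚ.*-distribˡ-+ (χ n) (+ suc b) (+ c))))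

  -- A B = A + A (B - 1), and B - 1 stays in the cone, since subtracting 1 only clears the constant
  -- term.
  strict-* : ∀ {A B} → Strict A → InCone B → coeff B 0 ≡ 1ℤ → Strict (A *ₛ B)
  strict-* {A} {B} A> B∈ B₀≡1 = strict-≈
    (solve 2 (λ a b → a :+ a :* (b :- :1) := a :* b) ≈-refl A B)
    (strict-+ A> (cone-* (strict⇒cone A>) (cone-minus-1 B∈ B₀≡1)))
    where open Solver

1-0 : 1ₛ -ₛ 0ₛ ≈ 1ₛ
1-0 = solve 0 (:1 :- :0 := :1) ≈-refl where open Solver

-- Partial sums of Cauchy's series

module Cauchy (p x y : PowerSeries) (xy≈p : x *ₛ y ≈ p)
              (p₀≡0 : coeff p 0 ≡ 0ℤ) (y₀≡0 : coeff y 0 ≡ 0ℤ) where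

  -- Their products `Π α N`, `Π β N`, `Π ξ N` are (p;p)_N, (y;p)_N and (x;p)_N.
  α β ξ : ℕ → PowerSeries
  α k = 1ₛ -ₛ p ^ₛ suc k
  β k = 1ₛ -ₛ y *ₛ p ^ₛ k
  ξ k = 1ₛ -ₛ x *ₛ p ^ₛ k

  z : ℕ → PowerSeries
  z n = y *ₛ p ^ₛ n

  c : ℕ → PowerSeries
  c s = Π ξ s *ₛ Π (inv ∘ α) s

  -- The truncation of F(z) = Σ_s (x;p)_s/(p;p)_s z^s to s < N, at z = y p^n. Raising n by one
  -- replaces z by p z.
  S : ℕ → ℕ → PowerSeries
  S n zero    = 0ₛ
  S n (suc N) = S n N +ₛ c N *ₛ z n ^ₛ N

  z-order : ∀ n → z n ≈[ suc n ] 0ₛ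
  z-order n = *ₛ-order-suc y₀≡0 (^ₛ-order n p₀≡0)

  unital-α : Unital α
  unital-α k = ≈[]-trans (+ₛ-cong[] ≈[]-refl (-ₛ-cong[] (^ₛ-order (suc k) p₀≡0)))
    (≈⇒≈[] 1-0)

  unital-β : Unital β
  unital-β k = ≈[]-trans (+ₛ-cong[] ≈[]-refl (-ₛ-cong[] (z-order k)))
    (≈⇒≈[] 1-0)

  α*c : ∀ N → α N *ₛ c (suc N) ≈ c N *ₛ ξ N
  α*c N = begin
    α N *ₛ (ξ N *ₛ Π ξ N *ₛ (inv (α N) *ₛ Π (inv ∘ α) N))
      ≈⟨ solve 5 (λ a t T i I → a :* (t :* T :* (i :* I)) := a :* i :* (T :* I :* t))
           ≈-refl (α N) (ξ N) (Π ξ N) (inv (α N)) (Π (inv ∘ α) N) ⟩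
    α N *ₛ inv (α N) *ₛ (c N *ₛ ξ N)
      ≈⟨ *ₛ-congʳ (*ₛ-inverseʳ (α N) (Unital₀ unital-α N)) ⟩
    1ₛ *ₛ (c N *ₛ ξ N)  ≈⟨ *ₛ-identityˡ _ ⟩
    c N *ₛ ξ N          ∎
    where
    open Solver
    open ≈-Reasoning

  Πα*c : ∀ N → Π α N *ₛ c N ≈ Π ξ N
  Πα*c zero    = solve 0 (:1 :* (:1 :* :1) := :1) ≈-refl where open Solver
  Πα*c (suc N) = begin
    α N *ₛ Π α N *ₛ c (suc N)    ≈⟨ solve 3 (λ a P c → a :* P :* c := P :* (a :* c)) ≈-refl
                                      (α N) (Π α N) (c (suc N)) ⟩
    Π α N *ₛ (α N *ₛ c (suc N))  ≈⟨ *ₛ-congˡ (α*c N) ⟩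
    Π α N *ₛ (c N *ₛ ξ N)        ≈⟨ solve 3 (λ P c t → P :* (c :* t) := t :* (P :* c)) ≈-refl
                                      (Π α N) (c N) (ξ N) ⟩
    ξ N *ₛ (Π α N *ₛ c N)        ≈⟨ *ₛ-congˡ (Πα*c N) ⟩
    ξ N *ₛ Π ξ N                 ∎
    where
    open Solver
    open ≈-Reasoning

  z-suc-^ : ∀ n N → z (suc n) ^ₛ N ≈ z n ^ₛ N *ₛ p ^ₛ N
  z-suc-^ n N = begin
    z (suc n) ^ₛ N       ≈⟨ ^-congˡ N (solve 3 (λ y p P → y :* (p :* P) := y :* P :* p) ≈-refl
                                          y p (p ^ₛ n)) ⟩
    (z n *ₛ p) ^ₛ N      ≈⟨ ^-distrib-* (z n) p N ⟩
    z n ^ₛ N *ₛ p ^ₛ N   ∎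
    where
    open Solver
    open ≈-Reasoning

  -- The q-difference equation of Σ_s (x;p)_s/(p;p)_s z^s, with the error of the truncation
  -- at s < N.
  S-step : ∀ n N → α n *ₛ S (suc n) N ≈ β n *ₛ S n N +ₛ c N *ₛ (1ₛ -ₛ p ^ₛ N) *ₛ z n ^ₛ N
  S-step n zero    = solve 2 (λ a b → a :* :0 := b :* :0 :+ :1 :* :1 :* (:1 :- :1) :* :1)
                       ≈-refl (α n) (β n)
    where open Solver
  S-step n (suc N) = begin
    α n *ₛ (S (suc n) N +ₛ c N *ₛ z (suc n) ^ₛ N)
      ≈⟨ distribˡ (α n) _ _ ⟩
    α n *ₛ S (suc n) N +ₛ α n *ₛ (c N *ₛ z (suc n) ^ₛ N)
      ≈⟨ +ₛ-cong (S-step n N) (*ₛ-congˡ (*ₛ-congˡ (z-suc-^ n N))) ⟩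
    β n *ₛ S n N +ₛ c N *ₛ (1ₛ -ₛ p ^ₛ N) *ₛ z n ^ₛ N +ₛ α n *ₛ (c N *ₛ (z n ^ₛ N *ₛ p ^ₛ N))
      ≈⟨ solve 7 (λ b s c P Z A p →
           b :* s :+ c :* (:1 :- P) :* Z :+ (:1 :- p :* A) :* (c :* (Z :* P)) :=
           b :* s :+ c :* Z :- c :* Z :* A :* P :* p)
         ≈-refl (β n) (S n N) (c N) (p ^ₛ N) (z n ^ₛ N) (p ^ₛ n) p ⟩
    β n *ₛ S n N +ₛ c N *ₛ z n ^ₛ N -ₛ c N *ₛ z n ^ₛ N *ₛ p ^ₛ n *ₛ p ^ₛ N *ₛ p
      -- The general equation is (1 - x z) F(p z) = (1 - z) F(z); x y = p turns 1 - x z into `α n`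
      -- at z = y p^n.
      ≈⟨ +ₛ-congˡ (-ₛ-cong (*ₛ-congˡ (≈-sym xy≈p))) ⟩
    β n *ₛ S n N +ₛ c N *ₛ z n ^ₛ N -ₛ c N *ₛ z n ^ₛ N *ₛ p ^ₛ n *ₛ p ^ₛ N *ₛ (x *ₛ y)
      ≈⟨ solve 7 (λ s c P Z A x y →
           (:1 :- y :* A) :* s :+ c :* Z :- c :* Z :* A :* P :* (x :* y) :=
           (:1 :- y :* A) :* (s :+ c :* Z) :+ c :* (:1 :- x :* P) :* (y :* A :* Z))
         ≈-refl (S n N) (c N) (p ^ₛ N) (z n ^ₛ N) (p ^ₛ n) x y ⟩
    β n *ₛ (S n N +ₛ c N *ₛ z n ^ₛ N) +ₛ c N *ₛ ξ N *ₛ z n ^ₛ suc N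
      ≈⟨ +ₛ-congˡ (*ₛ-congʳ (≈-trans (≈-sym (α*c N)) (*ₛ-comm (α N) (c (suc N))))) ⟩
    β n *ₛ S n (suc N) +ₛ c (suc N) *ₛ (1ₛ -ₛ p ^ₛ suc N) *ₛ z n ^ₛ suc N  ∎
    where
    open Solver
    open ≈-Reasoning

  -- Every term after s = 0 contains `z n`, which has order at least n + 1. So the series tends to 1
  -- as its argument moves on, and this is the boundary value of the iterated q-difference equation.
  S-order : ∀ n N → S n (suc N) ≈[ suc n ] 1ₛ
  S-order n zero    = ≈⇒≈[] (solve 0 (:0 :+ :1 :* :1 :* :1 := :1) ≈-refl) where open Solver
  S-order n (suc N) = ≈[]-trans
    (+ₛ-cong[] (S-order n N) (*ₛ-zeroʳ[] (c (suc N)) (*ₛ-zeroˡ[] (z n ^ₛ N) (z-order n))))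
    (≈⇒≈[] (+ₛ-identityʳ 1ₛ))

  -- Iterating `S-step` N + 1 times leads from `S 0` to a series that is 1 modulo q^(N+1). Each
  -- truncation error contains `z n ^ₛ suc N` and vanishes modulo q^(N+1).
  Cauchy-mod : ∀ N → Π α (suc N) ≈[ suc N ] Π β (suc N) *ₛ S 0 (suc N)
  Cauchy-mod N =
    ≈[]-trans (≈⇒≈[] (≈-sym (*ₛ-identityʳ _)))
    (≈[]-trans (*ₛ-cong[] (≈[]-refl {Π α (suc N)}) (≈[]-sym (≈[]-weaken (ℕₚ.n≤1+n _) (S-order (suc N) N))))
    (go (suc N)))
    where
    open Solver
    go : ∀ n → Π α n *ₛ S n (suc N) ≈[ suc N ] Π β n *ₛ S 0 (suc N)
    go zero    = ≈[]-refl
    go (suc n) =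
      ≈[]-trans (≈⇒≈[] (solve 3 (λ a P s → a :* P :* s := P :* (a :* s)) ≈-refl
                  (α n) (Π α n) (S (suc n) (suc N))))
      (≈[]-trans (*ₛ-cong[] (≈[]-refl {Π α n}) step)
      (≈[]-trans (≈⇒≈[] (solve 3 (λ P b s → P :* (b :* s) := b :* (P :* s)) ≈-refl
                  (Π α n) (β n) (S n (suc N))))
      (≈[]-trans (*ₛ-cong[] (≈[]-refl {β n}) (go n))
      (≈⇒≈[] (≈-sym (*ₛ-assoc (β n) (Π β n) (S 0 (suc N))))))))
      where
      step : α n *ₛ S (suc n) (suc N) ≈[ suc N ] β n *ₛ S n (suc N)
      step = ≈[]-trans (≈⇒≈[] (S-step n (suc N)))
        (≈[]-trans (+ₛ-cong[] (≈[]-refl {β n *ₛ S n (suc N)})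
          (*ₛ-zeroʳ[] (c (suc N) *ₛ (1ₛ -ₛ p ^ₛ suc N))
            (^ₛ-order (suc N) (at-below (z-order n) (s≤s z≤n)))))
        (≈⇒≈[] (+ₛ-identityʳ _)))

  module _ {Θ δ : ℕ → PowerSeries} (Θ-zero : Θ 0 ≈ 1ₛ) (Θ-suc : ∀ n → Θ (suc n) ≈ Θ n +ₛ δ n)
           (δ-spec : ∀ n → Π ξ (suc n) *ₛ (z n ^ₛ suc n *ₛ (1ₛ +ₛ p ^ₛ suc n)) ≈ Π β (suc n) *ₛ δ n)
    where

    -- On the diagonal N = n + 1 the truncation error of `S-step` and the newly added last term have
    -- the common factor z^(n+1), with coefficients that add up to 1 + p^(n+1). So the identity is
    -- exact at every n, with partial sums `Θ` of a theta series on the right; `δ-spec` is the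
    -- demand that this joint error be one increment of `Θ`.
    Πα*S : ∀ n → Π α n *ₛ S n (suc n) ≈ Π β n *ₛ Θ n
    Πα*S zero = begin
      1ₛ *ₛ (0ₛ +ₛ 1ₛ *ₛ 1ₛ *ₛ 1ₛ)  ≈⟨ solve 0 (:1 :* (:0 :+ :1 :* :1 :* :1) := :1 :* :1) ≈-refl ⟩
      1ₛ *ₛ 1ₛ                       ≈⟨ *ₛ-congˡ Θ-zero ⟨
      1ₛ *ₛ Θ 0                      ∎
      where
      open Solver
      open ≈-Reasoning
    Πα*S (suc n) = begin
      α n *ₛ Π α n *ₛ (S (suc n) (suc n) +ₛ c (suc n) *ₛ z (suc n) ^ₛ suc n)
        ≈⟨ solve 5 (λ a A s c w → a :* A :* (s :+ c :* w) := A :* (a :* s) :+ a :* A :* c :* w)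
             ≈-refl (α n) (Π α n) (S (suc n) (suc n)) (c (suc n)) (z (suc n) ^ₛ suc n) ⟩
      Π α n *ₛ (α n *ₛ S (suc n) (suc n)) +ₛ Π α (suc n) *ₛ c (suc n) *ₛ z (suc n) ^ₛ suc n
        ≈⟨ +ₛ-cong (*ₛ-congˡ (S-step n (suc n))) (*ₛ-congˡ (z-suc-^ n (suc n))) ⟩
      Π α n *ₛ (β n *ₛ S n (suc n) +ₛ c (suc n) *ₛ α n *ₛ z n ^ₛ suc n)
        +ₛ Π α (suc n) *ₛ c (suc n) *ₛ (z n ^ₛ suc n *ₛ p ^ₛ suc n)
        ≈⟨ solve 7 (λ a A b s c w P →
             A :* (b :* s :+ c :* a :* w) :+ a :* A :* c :* (w :* P) :=
             b :* (A :* s) :+ a :* A :* c :* (w :* (:1 :+ P)))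
             ≈-refl (α n) (Π α n) (β n) (S n (suc n)) (c (suc n)) (z n ^ₛ suc n) (p ^ₛ suc n) ⟩
      β n *ₛ (Π α n *ₛ S n (suc n)) +ₛ Π α (suc n) *ₛ c (suc n) *ₛ (z n ^ₛ suc n *ₛ (1ₛ +ₛ p ^ₛ suc n))
        ≈⟨ +ₛ-cong (*ₛ-congˡ (Πα*S n)) (*ₛ-congʳ (Πα*c (suc n))) ⟩
      β n *ₛ (Π β n *ₛ Θ n) +ₛ Π ξ (suc n) *ₛ (z n ^ₛ suc n *ₛ (1ₛ +ₛ p ^ₛ suc n))
        ≈⟨ +ₛ-congˡ (δ-spec n) ⟩
      β n *ₛ (Π β n *ₛ Θ n) +ₛ β n *ₛ Π β n *ₛ δ n
        ≈⟨ solve 4 (λ b B t d → b :* (B :* t) :+ b :* B :* d := b :* B :* (t :+ d)) ≈-refl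
             (β n) (Π β n) (Θ n) (δ n) ⟩
      β n *ₛ Π β n *ₛ (Θ n +ₛ δ n)
        ≈⟨ *ₛ-congˡ (Θ-suc n) ⟨
      β n *ₛ Π β n *ₛ Θ (suc n)  ∎
      where
      open Solver
      open ≈-Reasoning

    Πα∞≈Πβ∞*Θ : ∀ {Θ∞} → (∀ n → Θ n ≈[ suc n ] Θ∞) → Π∞ α ≈ Π∞ β *ₛ Θ∞
    Πα∞≈Πβ∞*Θ {Θ∞} limit = pointwise λ n → at-below (
      ≈[]-trans (≈[]-sym (Π-limit unital-α n))
      (≈[]-trans (≈⇒≈[] (≈-sym (*ₛ-identityʳ (Π α n))))
      (≈[]-trans (*ₛ-cong[] (≈[]-refl {Π α n}) (≈[]-sym (S-order n n)))
      (≈[]-trans (≈⇒≈[] (Πα*S n))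
      (*ₛ-cong[] (Π-limit unital-β n) (limit n)))))) (ℕₚ.n<1+n n)

  -- A separate hypothesis, because φ(-q) arises from x = -1, where `ξ 0` is 2 and has no inverse.
  module _ (x₀≡0 : coeff x 0 ≡ 0ℤ) where

    unital-ξ : Unital ξ
    unital-ξ k = ≈[]-trans (+ₛ-cong[] ≈[]-refl
      (-ₛ-cong[] (*ₛ-order-suc x₀≡0 (^ₛ-order k p₀≡0)))) (≈⇒≈[] 1-0)

    -- V N = Σ_{s<N} y^s / ((p;p)_s ∏_{s≤k<N} (1 - x p^k))
    V : ℕ → PowerSeries
    V zero    = 0ₛ
    V (suc N) = inv (ξ N) *ₛ (V N +ₛ y ^ₛ N *ₛ Π (inv ∘ α) N)

    Πξ*V : ∀ N → Π ξ N *ₛ V N ≈ S 0 N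
    Πξ*V zero    = *ₛ-identityˡ 0ₛ
    Πξ*V (suc N) = begin
      ξ N *ₛ Π ξ N *ₛ (inv (ξ N) *ₛ (V N +ₛ y ^ₛ N *ₛ Π (inv ∘ α) N))
        ≈⟨ solve 6 (λ t T i v w A → t :* T :* (i :* (v :+ w :* A)) :=
             t :* i :* (T :* v :+ T :* A :* w)) ≈-refl
             (ξ N) (Π ξ N) (inv (ξ N)) (V N) (y ^ₛ N) (Π (inv ∘ α) N) ⟩
      ξ N *ₛ inv (ξ N) *ₛ (Π ξ N *ₛ V N +ₛ c N *ₛ y ^ₛ N)
        ≈⟨ *ₛ-cong (*ₛ-inverseʳ (ξ N) (Unital₀ unital-ξ N))
             (+ₛ-cong (Πξ*V N) (*ₛ-congˡ (^-congˡ N (≈-sym (*ₛ-identityʳ y))))) ⟩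
      1ₛ *ₛ S 0 (suc N)  ≈⟨ *ₛ-identityˡ _ ⟩
      S 0 (suc N)        ∎
      where
      open Solver
      open ≈-Reasoning

    -- Here K is (p;p)_∞ / ((y;p)_∞ (x;p)_∞). Dividing Cauchy's theorem by (x;p)_∞ trades the
    -- numerators (x;p)_s, whose signs vary, for inverses of factors 1 - x p^k.
    V-limit : ∀ {K} → Π∞ α ≈ Π∞ β *ₛ Π∞ ξ *ₛ K → ∀ N → K ≈[ suc N ] V (suc N)
    V-limit {K} e N = *ₛ-cancelˡ[] (coeff-*₀ {Π∞ β} {Π∞ ξ} refl refl)
      (≈[]-trans (≈⇒≈[] (≈-sym e))
      (≈[]-trans (≈[]-sym (limit unital-α))
      (≈[]-trans (Cauchy-mod N)
      (≈[]-trans (*ₛ-cong[] (limit unital-β) (≈⇒≈[] (≈-sym (Πξ*V (suc N)))))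
      (≈[]-trans (*ₛ-cong[] (≈[]-refl {Π∞ β}) (*ₛ-cong[] (limit unital-ξ) (≈[]-refl {V (suc N)})))
      (≈⇒≈[] (≈-sym (*ₛ-assoc (Π∞ β) (Π∞ ξ) (V (suc N))))))))))
      where
      limit : ∀ {u} → Unital u → Π u (suc N) ≈[ suc N ] Π∞ u
      limit u₁ = ≈[]-weaken (ℕₚ.n≤1+n _) (Π-limit u₁ (suc N))

^ₛ-≡ : ∀ q {m n} → m ≡ n → q ^ₛ m ≈ q ^ₛ n
^ₛ-≡ q refl = ≈-refl

Π-≡ : ∀ u {m n} → m ≡ n → Π u m ≈ Π u n
Π-≡ u refl = ≈-refl

-- Bilateral sums, and theta series

sumℤₛ : ℕ → (ℤ → PowerSeries) → PowerSeries
sumℤₛ zero    g = g 0ℤ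
sumℤₛ (suc N) g = sumℤₛ N g +ₛ (g (+ suc N) +ₛ g -[1+ N ])

Summable : (ℤ → PowerSeries) → Set
Summable g = ∀ k → g k ≈[ ∣ k ∣ ] 0ₛ

sumℤ∞ : (ℤ → PowerSeries) → PowerSeries
coeff (sumℤ∞ g) n = coeff (sumℤₛ n g) n

sumℤ-limit : ∀ {g} → Summable g → ∀ N → sumℤₛ N g ≈[ suc N ] sumℤ∞ g
sumℤ-limit {g} summable N = below λ { (s≤s n≤N) → go (ℕₚ.≤⇒≤′ n≤N) }
  where
  go : ∀ {n N} → n ℕ.≤′ N → coeff (sumℤₛ N g) n ≡ coeff (sumℤₛ n g) n
  go (ℕ.≤′-reflexive refl) = refl
  go {n} {suc N} (ℕ.≤′-step n≤N) = trans (cong₂ ℤ._+_ (go n≤N)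
    (cong₂ ℤ._+_ (at-below (summable (+ suc N)) (s≤s (ℕₚ.≤′⇒≤ n≤N)))
                 (at-below (summable -[1+ N ]) (s≤s (ℕₚ.≤′⇒≤ n≤N)))))
    (ℤₚ.+-identityʳ _)

^ₛ-order-≤ : ∀ {A m n} → coeff A 0 ≡ 0ℤ → m ℕ.≤ n → A ^ₛ n ≈[ m ] 0ₛ
^ₛ-order-≤ A₀≡0 m≤n = ≈[]-weaken m≤n (^ₛ-order _ A₀≡0)

square : ℤ → ℕ
square k = ∣ k ∣ ℕ.* ∣ k ∣

-- 2k² + k; over k ∈ ℤ these are the triangular numbers.
hexagonal : ℤ → ℕ
hexagonal (+ n)    = n ℕ.* suc (2 ℕ.* n)
hexagonal -[1+ n ] = suc n ℕ.* suc (2 ℕ.* n)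

sign : ℤ → PowerSeries
sign k = (-ₛ 1ₛ) ^ₛ ∣ k ∣

-- φ⁻ q = φ(-q)
φ⁻-term ψ-term : PowerSeries → ℤ → PowerSeries
φ⁻-term q k = sign k *ₛ q ^ₛ square k
ψ-term  q k = q ^ₛ hexagonal k

φ⁻ ψ : PowerSeries → PowerSeries
φ⁻ q = sumℤ∞ (φ⁻-term q)
ψ  q = sumℤ∞ (ψ-term q)

m≤m*m : ∀ m → m ℕ.≤ m ℕ.* m
m≤m*m zero    = z≤n
m≤m*m (suc m) = ℕₚ.m≤m*n (suc m) (suc m)

∣k∣≤hexagonal : ∀ k → ∣ k ∣ ℕ.≤ hexagonal k
∣k∣≤hexagonal (+ n)    = ℕₚ.m≤m*n n (suc (2 ℕ.* n))
∣k∣≤hexagonal -[1+ n ] = ℕₚ.m≤m*n (suc n) (suc (2 ℕ.* n))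

euler : PowerSeries → PowerSeries
euler q = Π∞ (λ k → 1ₛ -ₛ q ^ₛ suc k)

eulerOdd : PowerSeries → PowerSeries
eulerOdd q = Π∞ (λ k → 1ₛ -ₛ q *ₛ (q *ₛ q) ^ₛ k)

euler-cong : ∀ {q r} → q ≈ r → euler q ≈ euler r
euler-cong e = Π∞-cong λ k → -ₛ-cong₂ ≈-refl (^-congˡ (suc k) e)

module _ {q : PowerSeries} (q₀≡0 : coeff q 0 ≡ 0ℤ) where

  summable-φ⁻ : Summable (φ⁻-term q)
  summable-φ⁻ k = *ₛ-zeroʳ[] (sign k) (^ₛ-order-≤ q₀≡0 (m≤m*m ∣ k ∣))

  summable-ψ : Summable (ψ-term q)
  summable-ψ k = ^ₛ-order-≤ q₀≡0 (∣k∣≤hexagonal k)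

  private
    q²₀≡0 : coeff (q *ₛ q) 0 ≡ 0ℤ
    q²₀≡0 = cong (λ z → z ℤ.* z ℤ.+ 0ℤ) q₀≡0

    -- For x = y = q and p = q² the families `ξ` and `β` coincide, so `δ-spec` only has to identify
    -- z^(n+1) (1 + p^(n+1)) with the terms ±(n + 1) of ψ. Moreover `β` and `α` are the odd and the
    -- even factors of `euler q`.
    module ΨC = Cauchy (q *ₛ q) q q ≈-refl q²₀≡0 q₀≡0

    square-^ : ∀ k → (q *ₛ q) ^ₛ k ≈ q ^ₛ (2 ℕ.* k)
    square-^ k = ≈-trans (^-congˡ k (*ₛ-congˡ (≈-sym (*ₛ-identityʳ q)))) (^-assocʳ q 2 k)

  euler≈eulerOdd*euler² : euler q ≈ eulerOdd q *ₛ euler (q *ₛ q)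
  euler≈eulerOdd*euler² = begin
    euler q                    ≈⟨ Π∞-blocks 2 unital-u blocks ⟨
    Π∞ (λ k → ΨC.β k *ₛ ΨC.α k)  ≈⟨ Π∞-* ΨC.unital-β ΨC.unital-α ⟩
    eulerOdd q *ₛ euler (q *ₛ q) ∎
    where
    open Solver
    open ≈-Reasoning
    u : ℕ → PowerSeries
    u k = 1ₛ -ₛ q ^ₛ suc k
    unital-u : Unital u
    unital-u k = ≈[]-trans (+ₛ-cong[] ≈[]-refl (-ₛ-cong[] (^ₛ-order (suc k) q₀≡0))) (≈⇒≈[] 1-0)
    blocks : ∀ N → Π (λ k → ΨC.β k *ₛ ΨC.α k) N ≈ Π u (2 ℕ.* N)
    blocks zero    = ≈-refl
    blocks (suc N) = begin
      ΨC.β N *ₛ ΨC.α N *ₛ Π (λ k → ΨC.β k *ₛ ΨC.α k) N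
        ≈⟨ *ₛ-cong (*ₛ-cong (-ₛ-cong₂ ≈-refl (*ₛ-congˡ (square-^ N)))
                            (-ₛ-cong₂ ≈-refl (≈-trans (square-^ (suc N)) (^ₛ-≡ q (ℕₚ.*-suc 2 N)))))
                   (blocks N) ⟩
      u (2 ℕ.* N) *ₛ u (suc (2 ℕ.* N)) *ₛ Π u (2 ℕ.* N)
        ≈⟨ solve 3 (λ a b P → a :* b :* P := b :* (a :* P)) ≈-refl
             (u (2 ℕ.* N)) (u (suc (2 ℕ.* N))) (Π u (2 ℕ.* N)) ⟩
      Π u (2 ℕ.+ 2 ℕ.* N)
        ≈⟨ Π-≡ u (ℕₚ.*-suc 2 N) ⟨
      Π u (2 ℕ.* suc N)  ∎

  gauss-ψ : ψ q *ₛ euler q ≈ euler (q *ₛ q) *ₛ euler (q *ₛ q)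
  gauss-ψ = begin
    ψ q *ₛ euler q                               ≈⟨ *ₛ-congˡ euler≈eulerOdd*euler² ⟩
    ψ q *ₛ (eulerOdd q *ₛ euler (q *ₛ q))        ≈⟨ solve 3 (λ a b c → a :* (b :* c) := b :* a :* c) ≈-refl
                                                      (ψ q) (eulerOdd q) (euler (q *ₛ q)) ⟩
    eulerOdd q *ₛ ψ q *ₛ euler (q *ₛ q)          ≈⟨ *ₛ-congʳ main ⟨
    euler (q *ₛ q) *ₛ euler (q *ₛ q)             ∎
    where
    open Solver
    open ≈-Reasoning
    δ : ℕ → PowerSeries
    δ n = ψ-term q (+ suc n) +ₛ ψ-term q -[1+ n ]
    δ≈ : ∀ n → ΨC.z n ^ₛ suc n *ₛ (1ₛ +ₛ (q *ₛ q) ^ₛ suc n) ≈ δ n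
    δ≈ n = begin
      ΨC.z n ^ₛ suc n *ₛ (1ₛ +ₛ (q *ₛ q) ^ₛ suc n)
        ≈⟨ *ₛ-cong (≈-trans (^-congˡ (suc n) (*ₛ-congˡ (square-^ n))) (^-assocʳ q (suc (2 ℕ.* n)) (suc n)))
                   (+ₛ-congˡ (square-^ (suc n))) ⟩
      q ^ₛ (suc (2 ℕ.* n) ℕ.* suc n) *ₛ (1ₛ +ₛ q ^ₛ (2 ℕ.* suc n))
        ≈⟨ solve 2 (λ a b → a :* (:1 :+ b) := a :* b :+ a) ≈-refl
             (q ^ₛ (suc (2 ℕ.* n) ℕ.* suc n)) (q ^ₛ (2 ℕ.* suc n)) ⟩
      q ^ₛ (suc (2 ℕ.* n) ℕ.* suc n) *ₛ q ^ₛ (2 ℕ.* suc n) +ₛ q ^ₛ (suc (2 ℕ.* n) ℕ.* suc n)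
        ≈⟨ +ₛ-cong (≈-sym (^-homo-* q (suc (2 ℕ.* n) ℕ.* suc n) (2 ℕ.* suc n))) ≈-refl ⟩
      q ^ₛ (suc (2 ℕ.* n) ℕ.* suc n ℕ.+ 2 ℕ.* suc n) +ₛ q ^ₛ (suc (2 ℕ.* n) ℕ.* suc n)
        ≈⟨ +ₛ-cong (^ₛ-≡ q (exponent n)) (^ₛ-≡ q (ℕₚ.*-comm (suc (2 ℕ.* n)) (suc n))) ⟩
      δ n  ∎
      where
      exponent : ∀ n → suc (2 ℕ.* n) ℕ.* suc n ℕ.+ 2 ℕ.* suc n ≡ suc n ℕ.* suc (2 ℕ.* suc n)
      exponent = ℕSolver.solve-∀
    main : euler (q *ₛ q) ≈ eulerOdd q *ₛ ψ q
    main = ΨC.Πα∞≈Πβ∞*Θ {λ n → sumℤₛ n (ψ-term q)} {δ} ≈-refl (λ _ → ≈-refl)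
      (λ n → *ₛ-congˡ (δ≈ n)) (sumℤ-limit summable-ψ)

  gauss-φ⁻ : φ⁻ q *ₛ euler (q *ₛ q) ≈ euler q *ₛ euler q
  gauss-φ⁻ = begin
    φ⁻ q *ₛ euler (q *ₛ q)           ≈⟨ *ₛ-congˡ (≈-sym euler-split) ⟩
    φ⁻ q *ₛ (euler q *ₛ Π∞ C.β)      ≈⟨ solve 3 (λ a b c → a :* (b :* c) := b :* (c :* a)) ≈-refl
                                          (φ⁻ q) (euler q) (Π∞ C.β) ⟩
    euler q *ₛ (Π∞ C.β *ₛ φ⁻ q)      ≈⟨ *ₛ-congˡ main ⟨
    euler q *ₛ euler q               ∎
    where
    open Solver
    open ≈-Reasoning
    -- Now `ξ k` is 1 + q^k and `β k` is 1 + q^(k+1): the same factors moved by one place, so that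
    -- their products differ only at the ends.
    module C = Cauchy q (-ₛ 1ₛ) (-ₛ q) (solve 1 (λ q → (:- :1) :* (:- q) := q) ≈-refl q)
                 q₀≡0 (cong -_ q₀≡0)
    euler-split : euler q *ₛ Π∞ C.β ≈ euler (q *ₛ q)
    euler-split = ≈-trans (≈-sym (Π∞-* C.unital-α C.unital-β)) (Π∞-cong λ k → begin
      (1ₛ -ₛ q *ₛ q ^ₛ k) *ₛ (1ₛ -ₛ (-ₛ q) *ₛ q ^ₛ k)
        ≈⟨ solve 2 (λ q r → (:1 :- q :* r) :* (:1 :- (:- q) :* r) := :1 :- (q :* r) :* (q :* r)) ≈-refl
             q (q ^ₛ k) ⟩
      1ₛ -ₛ q ^ₛ suc k *ₛ q ^ₛ suc k
        ≈⟨ -ₛ-cong₂ ≈-refl (^-distrib-* q q (suc k)) ⟨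
      1ₛ -ₛ (q *ₛ q) ^ₛ suc k  ∎)
    -- (-1;q)_(n+1) = 2 (-q;q)_n. The 2 becomes the two equal terms of φ(-q) at n + 1 and -(n + 1).
    two : ∀ n → Π C.ξ (suc n) *ₛ (1ₛ +ₛ q ^ₛ suc n) ≈ Π C.β (suc n) *ₛ (1ₛ +ₛ 1ₛ)
    two zero    = solve 1 (λ q → (:1 :- (:- :1) :* :1) :* :1 :* (:1 :+ q :* :1) :=
                                 (:1 :- (:- q) :* :1) :* :1 :* (:1 :+ :1)) ≈-refl q
    two (suc n) = begin
      C.ξ (suc n) *ₛ Π C.ξ (suc n) *ₛ (1ₛ +ₛ q ^ₛ suc (suc n))
        ≈⟨ solve 3 (λ T q r → (:1 :- (:- :1) :* r) :* T :* (:1 :+ q :* r) :=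
             (:1 :- (:- q) :* r) :* (T :* (:1 :+ r))) ≈-refl (Π C.ξ (suc n)) q (q ^ₛ suc n) ⟩
      C.β (suc n) *ₛ (Π C.ξ (suc n) *ₛ (1ₛ +ₛ q ^ₛ suc n))
        ≈⟨ *ₛ-congˡ (two n) ⟩
      C.β (suc n) *ₛ (Π C.β (suc n) *ₛ (1ₛ +ₛ 1ₛ))
        ≈⟨ ≈-sym (*ₛ-assoc (C.β (suc n)) (Π C.β (suc n)) (1ₛ +ₛ 1ₛ)) ⟩
      C.β (suc n) *ₛ Π C.β (suc n) *ₛ (1ₛ +ₛ 1ₛ)  ∎
    δ : ℕ → PowerSeries
    δ n = φ⁻-term q (+ suc n) +ₛ φ⁻-term q -[1+ n ]
    power : ∀ n → C.z n ^ₛ suc n ≈ φ⁻-term q (+ suc n)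
    power n = begin
      ((-ₛ q) *ₛ q ^ₛ n) ^ₛ suc n
        ≈⟨ ^-congˡ (suc n) (solve 2 (λ q r → (:- q) :* r := (:- :1) :* (q :* r)) ≈-refl q (q ^ₛ n)) ⟩
      ((-ₛ 1ₛ) *ₛ q ^ₛ suc n) ^ₛ suc n
        ≈⟨ ^-distrib-* (-ₛ 1ₛ) (q ^ₛ suc n) (suc n) ⟩
      (-ₛ 1ₛ) ^ₛ suc n *ₛ (q ^ₛ suc n) ^ₛ suc n
        ≈⟨ *ₛ-congˡ (^-assocʳ q (suc n) (suc n)) ⟩
      (-ₛ 1ₛ) ^ₛ suc n *ₛ q ^ₛ (suc n ℕ.* suc n)  ∎
    δ-spec : ∀ n → Π C.ξ (suc n) *ₛ (C.z n ^ₛ suc n *ₛ (1ₛ +ₛ q ^ₛ suc n)) ≈ Π C.β (suc n) *ₛ δ n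
    δ-spec n = begin
      Π C.ξ (suc n) *ₛ (C.z n ^ₛ suc n *ₛ (1ₛ +ₛ q ^ₛ suc n))
        ≈⟨ solve 3 (λ T z r → T :* (z :* r) := T :* r :* z) ≈-refl
             (Π C.ξ (suc n)) (C.z n ^ₛ suc n) (1ₛ +ₛ q ^ₛ suc n) ⟩
      Π C.ξ (suc n) *ₛ (1ₛ +ₛ q ^ₛ suc n) *ₛ C.z n ^ₛ suc n
        ≈⟨ *ₛ-cong (two n) (power n) ⟩
      Π C.β (suc n) *ₛ (1ₛ +ₛ 1ₛ) *ₛ φ⁻-term q (+ suc n)
        ≈⟨ solve 2 (λ B t → B :* (:1 :+ :1) :* t := B :* (t :+ t)) ≈-refl
             (Π C.β (suc n)) (φ⁻-term q (+ suc n)) ⟩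
      Π C.β (suc n) *ₛ δ n  ∎
    main : euler q ≈ Π∞ C.β *ₛ φ⁻ q
    main = C.Πα∞≈Πβ∞*Θ {λ n → sumℤₛ n (φ⁻-term q)} {δ}
      (solve 0 (:1 :* :1 := :1) ≈-refl) (λ _ → ≈-refl) δ-spec (sumℤ-limit summable-φ⁻)

-- Bilateral sums of integers

sumℤ : ℕ → (ℤ → ℤ) → ℤ
sumℤ zero    h = h 0ℤ
sumℤ (suc N) h = sumℤ N h ℤ.+ (h (+ suc N) ℤ.+ h -[1+ N ])

sumℤ-cong : ∀ {h h′} N → (∀ k → h k ≡ h′ k) → sumℤ N h ≡ sumℤ N h′
sumℤ-cong zero    e = e 0ℤ
sumℤ-cong (suc N) e = cong₂ ℤ._+_ (sumℤ-cong N e) (cong₂ ℤ._+_ (e (+ suc N)) (e -[1+ N ]))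

sumℤ-0 : ∀ {h} N → (∀ k → h k ≡ 0ℤ) → sumℤ N h ≡ 0ℤ
sumℤ-0 zero    e = e 0ℤ
sumℤ-0 (suc N) e = cong₂ ℤ._+_ (sumℤ-0 N e) (cong₂ ℤ._+_ (e (+ suc N)) (e -[1+ N ]))

sumℤ-+ : ∀ h h′ N → sumℤ N (λ k → h k ℤ.+ h′ k) ≡ sumℤ N h ℤ.+ sumℤ N h′
sumℤ-+ h h′ zero    = refl
sumℤ-+ h h′ (suc N) = trans (cong (ℤ._+ (h (+ suc N) ℤ.+ h′ (+ suc N) ℤ.+ (h -[1+ N ] ℤ.+ h′ -[1+ N ]))) (sumℤ-+ h h′ N))
  (regroup (sumℤ N h) (sumℤ N h′) (h (+ suc N)) (h′ (+ suc N)) (h -[1+ N ]) (h′ -[1+ N ]))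
  where
  regroup : ∀ a b x y z t → a ℤ.+ b ℤ.+ (x ℤ.+ y ℤ.+ (z ℤ.+ t)) ≡
                            a ℤ.+ (x ℤ.+ z) ℤ.+ (b ℤ.+ (y ℤ.+ t))
  regroup = ℤSolver.solve-∀

sumℤ-neg : ∀ h N → sumℤ N (λ k → - h k) ≡ - sumℤ N h
sumℤ-neg h zero    = refl
sumℤ-neg h (suc N) = trans (cong (ℤ._+ (- h (+ suc N) ℤ.+ - h -[1+ N ])) (sumℤ-neg h N))
  (regroup (sumℤ N h) (h (+ suc N)) (h -[1+ N ]))
  where
  regroup : ∀ a x y → - a ℤ.+ (- x ℤ.+ - y) ≡ - (a ℤ.+ (x ℤ.+ y))
  regroup = ℤSolver.solve-∀

sumℤ-comm : ∀ (h : ℤ → ℤ → ℤ) M N →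
            sumℤ M (λ i → sumℤ N (h i)) ≡ sumℤ N (λ j → sumℤ M (λ i → h i j))
sumℤ-comm h zero    N = refl
sumℤ-comm h (suc M) N = begin
  sumℤ M (λ i → sumℤ N (h i)) ℤ.+ (sumℤ N (h (+ suc M)) ℤ.+ sumℤ N (h -[1+ M ]))
    ≡⟨ cong₂ ℤ._+_ (sumℤ-comm h M N) (sym (sumℤ-+ (h (+ suc M)) (h -[1+ M ]) N)) ⟩
  sumℤ N (λ j → sumℤ M (λ i → h i j)) ℤ.+ sumℤ N (λ j → h (+ suc M) j ℤ.+ h -[1+ M ] j)
    ≡⟨ sumℤ-+ _ _ N ⟨
  sumℤ N (λ j → sumℤ (suc M) (λ i → h i j)) ∎
  where open ≡-Reasoning

sumℤ-reflect : ∀ h N → sumℤ N (h ∘ -_) ≡ sumℤ N h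
sumℤ-reflect h zero    = refl
sumℤ-reflect h (suc N) = cong₂ ℤ._+_ (sumℤ-reflect h N) (ℤₚ.+-comm (h -[1+ N ]) (h (+ suc N)))

SupportedIn : ℕ → (ℤ → ℤ) → Set
SupportedIn M h = ∀ k → M ℕ.< ∣ k ∣ → h k ≡ 0ℤ

sumℤ-shift₁ : ∀ h N → sumℤ N (λ k → h (1ℤ ℤ.+ k)) ℤ.+ h (- (+ N)) ≡ sumℤ N h ℤ.+ h (+ suc N)
sumℤ-shift₁ h zero    = ℤₚ.+-comm (h 1ℤ) (h 0ℤ)
sumℤ-shift₁ h (suc N) = begin
  S′ ℤ.+ (h (+ suc (suc N)) ℤ.+ h (1ℤ ℤ.+ -[1+ N ])) ℤ.+ h -[1+ N ]
    ≡⟨ cong (λ z → S′ ℤ.+ (h (+ suc (suc N)) ℤ.+ h z) ℤ.+ h -[1+ N ]) (1+-[1+z] (+ N)) ⟩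
  S′ ℤ.+ (h (+ suc (suc N)) ℤ.+ h (- (+ N))) ℤ.+ h -[1+ N ]
    ≡⟨ regroup S′ (h (+ suc (suc N))) (h (- (+ N))) (h -[1+ N ]) ⟩
  S′ ℤ.+ h (- (+ N)) ℤ.+ (h -[1+ N ] ℤ.+ h (+ suc (suc N)))
    ≡⟨ cong (ℤ._+ (h -[1+ N ] ℤ.+ h (+ suc (suc N)))) (sumℤ-shift₁ h N) ⟩
  sumℤ N h ℤ.+ h (+ suc N) ℤ.+ (h -[1+ N ] ℤ.+ h (+ suc (suc N)))
    ≡⟨ regroup′ (sumℤ N h) (h (+ suc N)) (h -[1+ N ]) (h (+ suc (suc N))) ⟩
  sumℤ N h ℤ.+ (h (+ suc N) ℤ.+ h -[1+ N ]) ℤ.+ h (+ suc (suc N)) ∎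
  where
  open ≡-Reasoning
  S′ = sumℤ N (λ k → h (1ℤ ℤ.+ k))
  1+-[1+z] : ∀ z → 1ℤ ℤ.+ - (1ℤ ℤ.+ z) ≡ - z
  1+-[1+z] = ℤSolver.solve-∀
  regroup : ∀ s a b c → s ℤ.+ (a ℤ.+ b) ℤ.+ c ≡ s ℤ.+ b ℤ.+ (c ℤ.+ a)
  regroup = ℤSolver.solve-∀
  regroup′ : ∀ s a b c → s ℤ.+ a ℤ.+ (b ℤ.+ c) ≡ s ℤ.+ (a ℤ.+ b) ℤ.+ c
  regroup′ = ℤSolver.solve-∀

∣k∣≤∣j+k∣+∣j∣ : ∀ j k → ∣ k ∣ ℕ.≤ ∣ j ℤ.+ k ∣ ℕ.+ ∣ j ∣
∣k∣≤∣j+k∣+∣j∣ j k = subst (ℕ._≤ ∣ j ℤ.+ k ∣ ℕ.+ ∣ j ∣) (cong ∣_∣ (cancel j k))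
  (ℤₚ.∣i-j∣≤∣i∣+∣j∣ (j ℤ.+ k) j)
  where
  cancel : ∀ j k → j ℤ.+ k - j ≡ k
  cancel = ℤSolver.solve-∀

supported-shift : ∀ {M h} j → SupportedIn M h → SupportedIn (M ℕ.+ ∣ j ∣) (λ k → h (j ℤ.+ k))
supported-shift {M} j supp k M+j<k = supp (j ℤ.+ k)
  (ℕₚ.+-cancelʳ-< ∣ j ∣ M _ (ℕₚ.<-≤-trans M+j<k (∣k∣≤∣j+k∣+∣j∣ j k)))

-- A shift by one moves one end term into the window and one out of it; M + j < N keeps both outside
-- the support at each of the j steps.
sumℤ-shift⁺ : ∀ {M h} j N → SupportedIn M h → M ℕ.+ j ℕ.< N →
              sumℤ N (λ k → h (+ j ℤ.+ k)) ≡ sumℤ N h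
sumℤ-shift⁺ {M} {h} zero N supp _ = sumℤ-cong N λ k → cong h (ℤₚ.+-identityˡ k)
sumℤ-shift⁺ {M} {h} (suc j) N supp M+j<N = begin
  sumℤ N (λ k → h (+ suc j ℤ.+ k))
    ≡⟨ sumℤ-cong N (λ k → cong h (regroup (+ j) k)) ⟩
  sumℤ N (λ k → h′ (1ℤ ℤ.+ k))
    ≡⟨ ℤₚ.+-identityʳ _ ⟨
  sumℤ N (λ k → h′ (1ℤ ℤ.+ k)) ℤ.+ 0ℤ
    ≡⟨ cong (λ z → sumℤ N (λ k → h′ (1ℤ ℤ.+ k)) ℤ.+ z)
         (sym (supp′ (- (+ N)) (subst (M ℕ.+ j ℕ.<_) (sym (ℤₚ.∣-i∣≡∣i∣ (+ N))) M+j<N′))) ⟩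
  sumℤ N (λ k → h′ (1ℤ ℤ.+ k)) ℤ.+ h′ (- (+ N))
    ≡⟨ sumℤ-shift₁ h′ N ⟩
  sumℤ N h′ ℤ.+ h′ (+ suc N)
    ≡⟨ cong₂ ℤ._+_ (sumℤ-shift⁺ j N supp M+j<N′) (supp′ (+ suc N) (ℕₚ.m<n⇒m<1+n M+j<N′)) ⟩
  sumℤ N h ℤ.+ 0ℤ
    ≡⟨ ℤₚ.+-identityʳ _ ⟩
  sumℤ N h ∎
  where
  open ≡-Reasoning
  h′ : ℤ → ℤ
  h′ k = h (+ j ℤ.+ k)
  supp′ : SupportedIn (M ℕ.+ j) h′
  supp′ = supported-shift (+ j) supp
  M+j<N′ : M ℕ.+ j ℕ.< N
  M+j<N′ = ℕₚ.<-trans (ℕₚ.+-monoʳ-< M (ℕₚ.n<1+n j)) M+j<N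
  regroup : ∀ j k → 1ℤ ℤ.+ j ℤ.+ k ≡ j ℤ.+ (1ℤ ℤ.+ k)
  regroup = ℤSolver.solve-∀
sumℤ-shift : ∀ {M h} j N → SupportedIn M h → M ℕ.+ ∣ j ∣ ℕ.< N →
             sumℤ N (λ k → h (j ℤ.+ k)) ≡ sumℤ N h
sumℤ-shift (+ j) N supp M+j<N = sumℤ-shift⁺ j N supp M+j<N
sumℤ-shift {M} {h} -[1+ j ] N supp M+j<N = begin
  sumℤ N (λ k → h (-[1+ j ] ℤ.+ k))
    ≡⟨ sumℤ-cong N (λ k → cong h (regroup (+ suc j) k)) ⟩
  sumℤ N (λ k → h (- (+ suc j ℤ.+ - k)))
    ≡⟨ sumℤ-reflect (λ k → h (- (+ suc j ℤ.+ k))) N ⟩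
  sumℤ N (λ k → h (- (+ suc j ℤ.+ k)))
    ≡⟨ sumℤ-shift⁺ {h = h ∘ -_} (suc j) N
         (λ k M<k → supp (- k) (subst (M ℕ.<_) (sym (ℤₚ.∣-i∣≡∣i∣ k)) M<k)) M+j<N ⟩
  sumℤ N (h ∘ -_)
    ≡⟨ sumℤ-reflect h N ⟩
  sumℤ N h ∎
  where
  open ≡-Reasoning
  regroup : ∀ j k → - j ℤ.+ k ≡ - (j ℤ.+ - k)
  regroup = ℤSolver.solve-∀

2ℤ 3ℤ 4ℤ : ℤ
2ℤ = + 2
3ℤ = + 3
4ℤ = + 4

-- The numbers 1 + 2k with |k| ≤ N run from 1 - 2N to 1 + 2N; the remaining odd number of the
-- window, -1 - 2N, gives the last term.
sumℤ-parity : ∀ h N → sumℤ (suc (2 ℕ.* N)) h ≡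
  sumℤ N (λ k → h (2ℤ ℤ.* k)) ℤ.+ sumℤ N (λ k → h (1ℤ ℤ.+ 2ℤ ℤ.* k)) ℤ.+ h -[1+ 2 ℕ.* N ]
sumℤ-parity h zero    = sym (ℤₚ.+-assoc (h 0ℤ) (h 1ℤ) (h -1ℤ))
sumℤ-parity h (suc N) = begin
  sumℤ (suc (2 ℕ.* suc N)) h
    ≡⟨ cong (λ m → sumℤ (suc m) h) (ℕₚ.*-suc 2 N) ⟩
  sumℤ (suc (2 ℕ.* N)) h ℤ.+ (h (+ suc (suc (2 ℕ.* N))) ℤ.+ h -[1+ suc (2 ℕ.* N) ])
    ℤ.+ (h (+ suc (suc (suc (2 ℕ.* N)))) ℤ.+ h -[1+ suc (suc (2 ℕ.* N)) ])
    ≡⟨ cong (λ z → z ℤ.+ (h (+ suc (suc (2 ℕ.* N))) ℤ.+ h -[1+ suc (2 ℕ.* N) ])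
         ℤ.+ (h (+ suc (suc (suc (2 ℕ.* N)))) ℤ.+ h -[1+ suc (suc (2 ℕ.* N)) ])) (sumℤ-parity h N) ⟩
  E ℤ.+ O ℤ.+ h -[1+ 2 ℕ.* N ] ℤ.+ (h (+ suc (suc (2 ℕ.* N))) ℤ.+ h -[1+ suc (2 ℕ.* N) ])
    ℤ.+ (h (+ suc (suc (suc (2 ℕ.* N)))) ℤ.+ h -[1+ suc (suc (2 ℕ.* N)) ])
    ≡⟨ regroup E O (h -[1+ 2 ℕ.* N ]) (h (+ suc (suc (2 ℕ.* N)))) (h -[1+ suc (2 ℕ.* N) ])
         (h (+ suc (suc (suc (2 ℕ.* N))))) (h -[1+ suc (suc (2 ℕ.* N)) ]) ⟩
  E ℤ.+ (h (+ suc (suc (2 ℕ.* N))) ℤ.+ h -[1+ suc (2 ℕ.* N) ])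
    ℤ.+ (O ℤ.+ (h (+ suc (suc (suc (2 ℕ.* N)))) ℤ.+ h -[1+ 2 ℕ.* N ])) ℤ.+ h -[1+ suc (suc (2 ℕ.* N)) ]
    ≡⟨ cong₂ ℤ._+_ (cong₂ ℤ._+_
         (cong (λ z → E ℤ.+ z) (cong₂ ℤ._+_ (cong h e₁) (cong h e₂)))
         (cong (λ z → O ℤ.+ z) (cong₂ ℤ._+_ (cong h e₃) (cong h e₄))))
         (cong (h ∘ -[1+_]) (sym (ℕₚ.*-suc 2 N))) ⟩
  sumℤ (suc N) (λ k → h (2ℤ ℤ.* k)) ℤ.+ sumℤ (suc N) (λ k → h (1ℤ ℤ.+ 2ℤ ℤ.* k))
    ℤ.+ h -[1+ 2 ℕ.* suc N ] ∎
  where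
  open ≡-Reasoning
  E = sumℤ N (λ k → h (2ℤ ℤ.* k))
  O = sumℤ N (λ k → h (1ℤ ℤ.+ 2ℤ ℤ.* k))
  2*pos : ∀ m → + (2 ℕ.* m) ≡ 2ℤ ℤ.* + m
  2*pos m = ℤₚ.pos-* 2 m
  e₁ : + suc (suc (2 ℕ.* N)) ≡ 2ℤ ℤ.* + suc N
  e₁ = trans (cong +_ (sym (ℕₚ.*-suc 2 N))) (2*pos (suc N))
  e₂ : -[1+ suc (2 ℕ.* N) ] ≡ 2ℤ ℤ.* -[1+ N ]
  e₂ = trans (cong -_ e₁) (ℤₚ.neg-distribʳ-* 2ℤ (+ suc N))
  e₃ : + suc (suc (suc (2 ℕ.* N))) ≡ 1ℤ ℤ.+ 2ℤ ℤ.* + suc N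
  e₃ = cong (λ z → 1ℤ ℤ.+ z) e₁
  e₄ : -[1+ 2 ℕ.* N ] ≡ 1ℤ ℤ.+ 2ℤ ℤ.* -[1+ N ]
  e₄ = cong (λ z → 1ℤ ℤ.+ z) e₂
  regroup : ∀ E O a b c d e → E ℤ.+ O ℤ.+ a ℤ.+ (b ℤ.+ c) ℤ.+ (d ℤ.+ e) ≡
                              E ℤ.+ (b ℤ.+ c) ℤ.+ (O ℤ.+ (d ℤ.+ a)) ℤ.+ e
  regroup = ℤSolver.solve-∀

-- The coefficient of q^n in q^z
δ : ℤ → ℕ → ℤ
δ z n = if does (z ℤₚ.≟ + n) then 1ℤ else 0ℤ

δ-≢ : ∀ {z n} → z ≢ + n → δ z n ≡ 0ℤ
δ-≢ {z} {n} z≢n rewrite dec-false (z ℤₚ.≟ + n) z≢n = refl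

i*i≡∣i∣*∣i∣ : ∀ i → i ℤ.* i ≡ + (∣ i ∣ ℕ.* ∣ i ∣)
i*i≡∣i∣*∣i∣ (+ n)    = sym (ℤₚ.pos-* n n)
i*i≡∣i∣*∣i∣ -[1+ n ] = refl

-- A common shape for the bounds on lattice points: each quadratic form below, or 4 times it, is a
-- sum of four squares that include the square of the variable to be bounded.
four-squares-bound : ∀ w a b c {m} →
  w ℤ.* w ℤ.+ (a ℤ.* a ℤ.+ (b ℤ.* b ℤ.+ c ℤ.* c)) ≡ + m → ∣ w ∣ ℕ.≤ m
four-squares-bound w a b c {m} e = begin
  ∣ w ∣            ≤⟨ m≤m*m ∣ w ∣ ⟩
  ∣ w ∣ ℕ.* ∣ w ∣  ≤⟨ ℕₚ.m≤m+n _ _ ⟩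
  ∣ w ∣ ℕ.* ∣ w ∣ ℕ.+ (∣ a ∣ ℕ.* ∣ a ∣ ℕ.+ (∣ b ∣ ℕ.* ∣ b ∣ ℕ.+ ∣ c ∣ ℕ.* ∣ c ∣))
    ≡⟨ ℤₚ.+-injective (trans (sym pos) e) ⟩
  m                ∎
  where
  open ℕₚ.≤-Reasoning
  pos : w ℤ.* w ℤ.+ (a ℤ.* a ℤ.+ (b ℤ.* b ℤ.+ c ℤ.* c)) ≡
        + (∣ w ∣ ℕ.* ∣ w ∣ ℕ.+ (∣ a ∣ ℕ.* ∣ a ∣ ℕ.+ (∣ b ∣ ℕ.* ∣ b ∣ ℕ.+ ∣ c ∣ ℕ.* ∣ c ∣)))
  pos rewrite i*i≡∣i∣*∣i∣ w | i*i≡∣i∣*∣i∣ a | i*i≡∣i∣*∣i∣ b | i*i≡∣i∣*∣i∣ c = refl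

sumℤ-shift-bounded : ∀ {M J h} j N → SupportedIn M h → (J ℕ.< ∣ j ∣ → ∀ k → h k ≡ 0ℤ) →
                     M ℕ.+ J ℕ.< N → sumℤ N (λ k → h (j ℤ.+ k)) ≡ sumℤ N h
sumℤ-shift-bounded {M} {J} j N supp vanish M+J<N with ∣ j ∣ ℕₚ.≤? J
... | yes j≤J = sumℤ-shift j N supp (ℕₚ.≤-<-trans (ℕₚ.+-monoʳ-≤ M j≤J) M+J<N)
... | no  j≰J = trans (sumℤ-0 N λ k → vanish (ℕₚ.≰⇒> j≰J) (j ℤ.+ k))
                  (sym (sumℤ-0 N (vanish (ℕₚ.≰⇒> j≰J))))

-- s² + 3 t² at s = t + v
form : ℤ → ℤ → ℤ
form t v = 4ℤ ℤ.* (t ℤ.* t) ℤ.+ (2ℤ ℤ.* (t ℤ.* v) ℤ.+ v ℤ.* v)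

form-bound₁ : ∀ t v {n} → form t v ≡ + n → ∣ t ∣ ℕ.≤ n
form-bound₁ t v e = four-squares-bound t t t (t ℤ.+ v) (trans (ring t v) e)
  where
  ring : ∀ t v → t ℤ.* t ℤ.+ (t ℤ.* t ℤ.+ (t ℤ.* t ℤ.+ (t ℤ.+ v) ℤ.* (t ℤ.+ v))) ≡
                 4ℤ ℤ.* (t ℤ.* t) ℤ.+ (2ℤ ℤ.* (t ℤ.* v) ℤ.+ v ℤ.* v)
  ring = ℤSolver.solve-∀

form-bound₂ : ∀ t v {n} → form t v ≡ + n → ∣ v ∣ ℕ.≤ 4 ℕ.* n
form-bound₂ t v {n} e = four-squares-bound v v v (4ℤ ℤ.* t ℤ.+ v)
  (trans (ring t v) (trans (cong (4ℤ ℤ.*_) e) (sym (ℤₚ.pos-* 4 n))))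
  where
  ring : ∀ t v → v ℤ.* v ℤ.+ (v ℤ.* v ℤ.+ (v ℤ.* v ℤ.+ (4ℤ ℤ.* t ℤ.+ v) ℤ.* (4ℤ ℤ.* t ℤ.+ v))) ≡
                 4ℤ ℤ.* (4ℤ ℤ.* (t ℤ.* t) ℤ.+ (2ℤ ℤ.* (t ℤ.* v) ℤ.+ v ℤ.* v))
  ring = ℤSolver.solve-∀

∣k∣≤1+∣1+c*k∣ : ∀ c k → ∣ k ∣ ℕ.≤ suc ∣ 1ℤ ℤ.+ + suc c ℤ.* k ∣
∣k∣≤1+∣1+c*k∣ c k = begin
  ∣ k ∣                            ≤⟨ ℕₚ.m≤n*m ∣ k ∣ (suc c) ⟩
  suc c ℕ.* ∣ k ∣                  ≡⟨ ℤₚ.abs-* (+ suc c) k ⟨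
  ∣ + suc c ℤ.* k ∣                ≤⟨ ∣k∣≤∣j+k∣+∣j∣ 1ℤ (+ suc c ℤ.* k) ⟩
  ∣ 1ℤ ℤ.+ + suc c ℤ.* k ∣ ℕ.+ 1   ≡⟨ ℕₚ.+-comm _ 1 ⟩
  suc ∣ 1ℤ ℤ.+ + suc c ℤ.* k ∣     ∎
  where open ℕₚ.≤-Reasoning

-- The lattice bijection for odd n, on finite windows

module Lattice (n : ℕ) (n-odd : ∀ w → 2ℤ ℤ.* w ≢ + n) (K : ℕ) (n≪K : suc (suc (4 ℕ.* n)) ℕ.< K) where

  -- `split-mod-4` narrows the window from N to N′ and then to K. K > 4n + 2 leaves room for the
  -- support bound 4n + 1 of the sums over b and for the shift by one in `reflect`.
  N′ N : ℕ
  N′ = suc (2 ℕ.* K)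
  N  = suc (2 ℕ.* N′)

  K≤N′ : K ℕ.≤ N′
  K≤N′ = ℕₚ.m≤n⇒m≤1+n (ℕₚ.m≤n*m K 2)

  K+K<N : K ℕ.+ K ℕ.< N
  K+K<N = s≤s (ℕₚ.≤-trans (ℕₚ.+-mono-≤ K≤N′ K≤N′) (ℕₚ.≤-reflexive (cong (N′ ℕ.+_) (sym (ℕₚ.+-identityʳ N′)))))

  n≤K : n ℕ.≤ K
  n≤K = ℕₚ.≤-trans (ℕₚ.m≤n*m n 4) (ℕₚ.<⇒≤ (ℕₚ.<-trans (ℕₚ.n<1+n _) (ℕₚ.<-trans (ℕₚ.n<1+n _) n≪K)))

  4n+1<K : suc (4 ℕ.* n) ℕ.< K
  4n+1<K = ℕₚ.<-trans (ℕₚ.n<1+n _) n≪K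

  F : ℤ → ℤ → ℤ
  F t v = δ (form t v) n

  F-vanish₁ : ∀ {t} → n ℕ.< ∣ t ∣ → ∀ v → F t v ≡ 0ℤ
  F-vanish₁ {t} n<t v = δ-≢ (λ e → ℕₚ.<⇒≱ n<t (form-bound₁ t v e))

  F-vanish₂ : ∀ t → SupportedIn (4 ℕ.* n) (F t)
  F-vanish₂ t v 4n<v = δ-≢ (λ e → ℕₚ.<⇒≱ 4n<v (form-bound₂ t v e))

  F-affine-vanish : ∀ t c → SupportedIn (suc (4 ℕ.* n)) (λ k → F t (1ℤ ℤ.+ + suc c ℤ.* k))
  F-affine-vanish t c k 4n+1<k = F-vanish₂ t _ (ℕₚ.≤-pred (ℕₚ.<-≤-trans 4n+1<k (∣k∣≤1+∣1+c*k∣ c k)))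

  shear : ∀ t → sumℤ N (λ s → δ (s ℤ.* s ℤ.+ 3ℤ ℤ.* (t ℤ.* t)) n) ≡ sumℤ N (F t)
  shear t = sym (begin
    sumℤ N (F t)                    ≡⟨ sumℤ-cong N (λ v → cong (λ z → δ z n) (ring t v)) ⟩
    sumℤ N (λ v → h (t ℤ.+ v))      ≡⟨ sumℤ-shift-bounded t N supp vanish
                                         (ℕₚ.≤-<-trans (ℕₚ.+-mono-≤ n≤K n≤K) K+K<N) ⟩
    sumℤ N h                        ∎)
    where
    open ≡-Reasoning
    h : ℤ → ℤ
    h s = δ (s ℤ.* s ℤ.+ 3ℤ ℤ.* (t ℤ.* t)) n
    ring : ∀ t v → 4ℤ ℤ.* (t ℤ.* t) ℤ.+ (2ℤ ℤ.* (t ℤ.* v) ℤ.+ v ℤ.* v) ≡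
                   (t ℤ.+ v) ℤ.* (t ℤ.+ v) ℤ.+ 3ℤ ℤ.* (t ℤ.* t)
    ring = ℤSolver.solve-∀
    ring₁ : ∀ s t → s ℤ.* s ℤ.+ (t ℤ.* t ℤ.+ (t ℤ.* t ℤ.+ t ℤ.* t)) ≡ s ℤ.* s ℤ.+ 3ℤ ℤ.* (t ℤ.* t)
    ring₁ = ℤSolver.solve-∀
    ring₂ : ∀ s t → t ℤ.* t ℤ.+ (s ℤ.* s ℤ.+ (t ℤ.* t ℤ.+ t ℤ.* t)) ≡ s ℤ.* s ℤ.+ 3ℤ ℤ.* (t ℤ.* t)
    ring₂ = ℤSolver.solve-∀
    supp : SupportedIn n h
    supp s n<s = δ-≢ (λ e → ℕₚ.<⇒≱ n<s (four-squares-bound s t t t (trans (ring₁ s t) e)))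
    vanish : n ℕ.< ∣ t ∣ → ∀ s → h s ≡ 0ℤ
    vanish n<t s = δ-≢ (λ e → ℕₚ.<⇒≱ n<t (four-squares-bound t s t t (trans (ring₂ s t) e)))

  -- Even v make the form even, which odd n excludes; a second split by parity sorts the odd v into
  -- the classes 1 and 3 modulo 4.
  split-mod-4 : ∀ t → sumℤ N (F t) ≡ sumℤ K (λ b → F t (1ℤ ℤ.+ 2ℤ ℤ.* (2ℤ ℤ.* b)))
                           ℤ.+ sumℤ K (λ b → F t (1ℤ ℤ.+ 2ℤ ℤ.* (1ℤ ℤ.+ 2ℤ ℤ.* b)))
  split-mod-4 t = begin
    sumℤ N (F t)
      ≡⟨ sumℤ-parity (F t) N′ ⟩
    sumℤ N′ (λ w → F t (2ℤ ℤ.* w)) ℤ.+ sumℤ N′ (λ w → F t (1ℤ ℤ.+ 2ℤ ℤ.* w)) ℤ.+ F t -[1+ 2 ℕ.* N′ ]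
      ≡⟨ cong₂ ℤ._+_ (cong (ℤ._+ sumℤ N′ (λ w → F t (1ℤ ℤ.+ 2ℤ ℤ.* w))) (sumℤ-0 N′ even))
           (F-vanish₂ t _ (ℕₚ.<-trans (ℕₚ.n<1+n _) (ℕₚ.<-≤-trans 4n+1<K
             (ℕₚ.≤-trans K≤N′ (ℕₚ.m≤n⇒m≤1+n (ℕₚ.m≤n*m N′ 2)))))) ⟩
    0ℤ ℤ.+ sumℤ N′ (λ w → F t (1ℤ ℤ.+ 2ℤ ℤ.* w)) ℤ.+ 0ℤ
      ≡⟨ trans (ℤₚ.+-identityʳ _) (ℤₚ.+-identityˡ _) ⟩
    sumℤ N′ (λ w → F t (1ℤ ℤ.+ 2ℤ ℤ.* w))
      ≡⟨ sumℤ-parity (λ w → F t (1ℤ ℤ.+ 2ℤ ℤ.* w)) K ⟩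
    sumℤ K (λ b → F t (1ℤ ℤ.+ 2ℤ ℤ.* (2ℤ ℤ.* b)))
      ℤ.+ sumℤ K (λ b → F t (1ℤ ℤ.+ 2ℤ ℤ.* (1ℤ ℤ.+ 2ℤ ℤ.* b))) ℤ.+ F t (1ℤ ℤ.+ 2ℤ ℤ.* -[1+ 2 ℕ.* K ])
      ≡⟨ cong (λ z → sumℤ K (λ b → F t (1ℤ ℤ.+ 2ℤ ℤ.* (2ℤ ℤ.* b)))
           ℤ.+ sumℤ K (λ b → F t (1ℤ ℤ.+ 2ℤ ℤ.* (1ℤ ℤ.+ 2ℤ ℤ.* b))) ℤ.+ z)
           (F-affine-vanish t 1 -[1+ 2 ℕ.* K ] (ℕₚ.<-≤-trans 4n+1<K K≤N′)) ⟩
    sumℤ K (λ b → F t (1ℤ ℤ.+ 2ℤ ℤ.* (2ℤ ℤ.* b)))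
      ℤ.+ sumℤ K (λ b → F t (1ℤ ℤ.+ 2ℤ ℤ.* (1ℤ ℤ.+ 2ℤ ℤ.* b))) ℤ.+ 0ℤ
      ≡⟨ ℤₚ.+-identityʳ _ ⟩
    sumℤ K (λ b → F t (1ℤ ℤ.+ 2ℤ ℤ.* (2ℤ ℤ.* b)))
      ℤ.+ sumℤ K (λ b → F t (1ℤ ℤ.+ 2ℤ ℤ.* (1ℤ ℤ.+ 2ℤ ℤ.* b))) ∎
    where
    open ≡-Reasoning
    ring : ∀ t w → 2ℤ ℤ.* (2ℤ ℤ.* (t ℤ.* t) ℤ.+ (2ℤ ℤ.* (t ℤ.* w) ℤ.+ 2ℤ ℤ.* (w ℤ.* w))) ≡
                   4ℤ ℤ.* (t ℤ.* t) ℤ.+ (2ℤ ℤ.* (t ℤ.* (2ℤ ℤ.* w)) ℤ.+ 2ℤ ℤ.* w ℤ.* (2ℤ ℤ.* w))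
    ring = ℤSolver.solve-∀
    even : ∀ w → F t (2ℤ ℤ.* w) ≡ 0ℤ
    even w = δ-≢ (λ e → n-odd _ (trans (ring t w) e))

  -- The form is invariant under (t, v) ↦ (-t, -v), which carries v ≡ 3 to v ≡ 1 (mod 4): 3 + 4b =
  -- -(1 + 4(-1 - b)).
  reflect : ∀ t → sumℤ K (λ b → F t (1ℤ ℤ.+ 2ℤ ℤ.* (1ℤ ℤ.+ 2ℤ ℤ.* b))) ≡
                sumℤ K (λ b → F (- t) (1ℤ ℤ.+ 4ℤ ℤ.* b))
  reflect t = begin
    sumℤ K (λ b → F t (1ℤ ℤ.+ 2ℤ ℤ.* (1ℤ ℤ.+ 2ℤ ℤ.* b)))
      ≡⟨ sumℤ-cong K (λ b → cong (λ z → δ z n) (ring t b)) ⟩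
    sumℤ K (λ b → h (-1ℤ ℤ.+ - b))
      ≡⟨ sumℤ-reflect (λ b → h (-1ℤ ℤ.+ b)) K ⟩
    sumℤ K (λ b → h (-1ℤ ℤ.+ b))
      ≡⟨ sumℤ-shift -1ℤ K (F-affine-vanish (- t) 3)
           (subst (ℕ._< K) (ℕₚ.+-comm 1 (suc (4 ℕ.* n))) n≪K) ⟩
    sumℤ K h ∎
    where
    open ≡-Reasoning
    h : ℤ → ℤ
    h b = F (- t) (1ℤ ℤ.+ 4ℤ ℤ.* b)
    ring : ∀ t b →
      let v = 1ℤ ℤ.+ 2ℤ ℤ.* (1ℤ ℤ.+ 2ℤ ℤ.* b) ; v′ = 1ℤ ℤ.+ 4ℤ ℤ.* (-1ℤ ℤ.+ - b) in
      4ℤ ℤ.* (t ℤ.* t) ℤ.+ (2ℤ ℤ.* (t ℤ.* v) ℤ.+ v ℤ.* v) ≡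
      4ℤ ℤ.* (- t ℤ.* - t) ℤ.+ (2ℤ ℤ.* (- t ℤ.* v′) ℤ.+ v′ ℤ.* v′)
    ring = ℤSolver.solve-∀

  -- The substitution t = a - b makes u = 4t + v equal to 1 + 4a when v = 1 + 4b, and this removes
  -- the mixed term.
  unshear : ∀ b → sumℤ N (λ t → F t (1ℤ ℤ.+ 4ℤ ℤ.* b)) ≡
    sumℤ N (λ a → δ (1ℤ ℤ.+ (2ℤ ℤ.* (2ℤ ℤ.* (a ℤ.* a) ℤ.+ a) ℤ.+ + 6 ℤ.* (2ℤ ℤ.* (b ℤ.* b) ℤ.+ b))) n)
  unshear b = sym (begin
    sumℤ N (λ a → δ (1ℤ ℤ.+ (2ℤ ℤ.* (2ℤ ℤ.* (a ℤ.* a) ℤ.+ a) ℤ.+ + 6 ℤ.* (2ℤ ℤ.* (b ℤ.* b) ℤ.+ b))) n)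
      ≡⟨ sumℤ-cong N (λ a → cong (λ z → δ z n) (ring a b)) ⟩
    sumℤ N (λ a → h (- b ℤ.+ a))
      ≡⟨ sumℤ-shift-bounded (- b) N (λ t n<t → F-vanish₁ {t} n<t (1ℤ ℤ.+ 4ℤ ℤ.* b))
           (λ 4n+1<b t → F-affine-vanish t 3 b (subst (suc (4 ℕ.* n) ℕ.<_) (ℤₚ.∣-i∣≡∣i∣ b) 4n+1<b))
           (ℕₚ.≤-<-trans (ℕₚ.+-mono-≤ n≤K (ℕₚ.<⇒≤ 4n+1<K)) K+K<N) ⟩
    sumℤ N h ∎)
    where
    open ≡-Reasoning
    h : ℤ → ℤ
    h t = F t (1ℤ ℤ.+ 4ℤ ℤ.* b)
    ring : ∀ a b → let t = - b ℤ.+ a ; v = 1ℤ ℤ.+ 4ℤ ℤ.* b in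
      1ℤ ℤ.+ (2ℤ ℤ.* (2ℤ ℤ.* (a ℤ.* a) ℤ.+ a) ℤ.+ + 6 ℤ.* (2ℤ ℤ.* (b ℤ.* b) ℤ.+ b)) ≡
      4ℤ ℤ.* (t ℤ.* t) ℤ.+ (2ℤ ℤ.* (t ℤ.* v) ℤ.+ v ℤ.* v)
    ring = ℤSolver.solve-∀

  lattice : sumℤ N (λ s → sumℤ N (λ t → δ (s ℤ.* s ℤ.+ 3ℤ ℤ.* (t ℤ.* t)) n)) ≡ 2ℤ ℤ.*
    sumℤ K (λ b → sumℤ N (λ a →
      δ (1ℤ ℤ.+ (2ℤ ℤ.* (2ℤ ℤ.* (a ℤ.* a) ℤ.+ a) ℤ.+ + 6 ℤ.* (2ℤ ℤ.* (b ℤ.* b) ℤ.+ b))) n))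
  lattice = begin
    sumℤ N (λ s → sumℤ N (λ t → δ (s ℤ.* s ℤ.+ 3ℤ ℤ.* (t ℤ.* t)) n))
      ≡⟨ sumℤ-comm _ N N ⟩
    sumℤ N (λ t → sumℤ N (λ s → δ (s ℤ.* s ℤ.+ 3ℤ ℤ.* (t ℤ.* t)) n))
      ≡⟨ sumℤ-cong N (λ t → trans (shear t) (trans (split-mod-4 t) (cong₂ ℤ._+_ (first t) (reflect t)))) ⟩
    sumℤ N (λ t → D t ℤ.+ D (- t))
      ≡⟨ sumℤ-+ D (D ∘ -_) N ⟩
    sumℤ N D ℤ.+ sumℤ N (D ∘ -_)
      ≡⟨ cong (λ z → sumℤ N D ℤ.+ z) (sumℤ-reflect D N) ⟩
    sumℤ N D ℤ.+ sumℤ N D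
      ≡⟨ double (sumℤ N D) ⟩
    2ℤ ℤ.* sumℤ N D
      ≡⟨ cong (2ℤ ℤ.*_) (sumℤ-comm _ N K) ⟩
    2ℤ ℤ.* sumℤ K (λ b → sumℤ N (λ t → F t (1ℤ ℤ.+ 4ℤ ℤ.* b)))
      ≡⟨ cong (2ℤ ℤ.*_) (sumℤ-cong K unshear) ⟩
    _ ∎
    where
    open ≡-Reasoning
    D : ℤ → ℤ
    D t = sumℤ K (λ b → F t (1ℤ ℤ.+ 4ℤ ℤ.* b))
    double : ∀ x → x ℤ.+ x ≡ 2ℤ ℤ.* x
    double = ℤSolver.solve-∀
    four : ∀ b → 1ℤ ℤ.+ 2ℤ ℤ.* (2ℤ ℤ.* b) ≡ 1ℤ ℤ.+ 4ℤ ℤ.* b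
    four = ℤSolver.solve-∀
    first : ∀ t → sumℤ K (λ b → F t (1ℤ ℤ.+ 2ℤ ℤ.* (2ℤ ℤ.* b))) ≡ D t
    first t = sumℤ-cong K (λ b → cong (F t) (four b))

coeff-sumℤₛ : ∀ N g n → coeff (sumℤₛ N g) n ≡ sumℤ N (λ k → coeff (g k) n)
coeff-sumℤₛ zero    g n = refl
coeff-sumℤₛ (suc N) g n =
  cong (ℤ._+ (coeff (g (+ suc N)) n ℤ.+ coeff (g -[1+ N ]) n)) (coeff-sumℤₛ N g n)

sumℤₛ-cong : ∀ N {g h} → (∀ k → g k ≈ h k) → sumℤₛ N g ≈ sumℤₛ N h
sumℤₛ-cong zero    e = e 0ℤ
sumℤₛ-cong (suc N) e = +ₛ-cong (sumℤₛ-cong N e) (+ₛ-cong (e (+ suc N)) (e -[1+ N ]))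

*ₛ-distribˡ-sumℤₛ : ∀ A g N → A *ₛ sumℤₛ N g ≈ sumℤₛ N (λ k → A *ₛ g k)
*ₛ-distribˡ-sumℤₛ A g zero    = ≈-refl
*ₛ-distribˡ-sumℤₛ A g (suc N) = ≈-trans (distribˡ A _ _)
  (+ₛ-cong (*ₛ-distribˡ-sumℤₛ A g N) (distribˡ A (g (+ suc N)) (g -[1+ N ])))

*ₛ-distribʳ-sumℤₛ : ∀ A g N → sumℤₛ N g *ₛ A ≈ sumℤₛ N (λ k → g k *ₛ A)
*ₛ-distribʳ-sumℤₛ A g N = ≈-trans (*ₛ-comm (sumℤₛ N g) A)
  (≈-trans (*ₛ-distribˡ-sumℤₛ A g N) (sumℤₛ-cong N (λ k → *ₛ-comm A (g k))))

coeff-*-sumℤ∞ : ∀ {g h} → Summable g → Summable h → ∀ A {M N n} → n ℕ.≤ M → n ℕ.≤ N →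
  coeff (A *ₛ (sumℤ∞ g *ₛ sumℤ∞ h)) n ≡
  sumℤ M (λ i → sumℤ N (λ j → coeff (A *ₛ (g i *ₛ h j)) n))
coeff-*-sumℤ∞ {g} {h} sg sh A {M} {N} {n} n≤M n≤N = begin
  coeff (A *ₛ (sumℤ∞ g *ₛ sumℤ∞ h)) n
    ≡⟨ at-below (*ₛ-cong[] (≈[]-refl {A}) (*ₛ-cong[] (limit sg n≤M) (limit sh n≤N))) (ℕₚ.n<1+n n) ⟩
  coeff (A *ₛ (sumℤₛ M g *ₛ sumℤₛ N h)) n
    ≡⟨ at expand n ⟩
  coeff (sumℤₛ M (λ i → sumℤₛ N (λ j → A *ₛ (g i *ₛ h j)))) n
    ≡⟨ coeff-sumℤₛ M _ n ⟩
  sumℤ M (λ i → coeff (sumℤₛ N (λ j → A *ₛ (g i *ₛ h j))) n)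
    ≡⟨ sumℤ-cong M (λ i → coeff-sumℤₛ N _ n) ⟩
  sumℤ M (λ i → sumℤ N (λ j → coeff (A *ₛ (g i *ₛ h j)) n)) ∎
  where
  open ≡-Reasoning
  limit : ∀ {g} → Summable g → ∀ {N} → n ℕ.≤ N → sumℤ∞ g ≈[ suc n ] sumℤₛ N g
  limit sg {N} n≤N = ≈[]-sym (≈[]-weaken (s≤s n≤N) (sumℤ-limit sg N))
  expand : A *ₛ (sumℤₛ M g *ₛ sumℤₛ N h) ≈ sumℤₛ M (λ i → sumℤₛ N (λ j → A *ₛ (g i *ₛ h j)))
  expand = ≈-trans (*ₛ-congˡ (*ₛ-distribʳ-sumℤₛ (sumℤₛ N h) g M))
    (≈-trans (*ₛ-distribˡ-sumℤₛ A _ M) (sumℤₛ-cong M λ i →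
      ≈-trans (*ₛ-congˡ (*ₛ-distribˡ-sumℤₛ (g i) h N)) (*ₛ-distribˡ-sumℤₛ A _ N)))

-- Coefficients of the theta products

ε : ℤ → ℤ
ε k = -1ℤ ℤ.^ ∣ k ∣

sign≈constant : ∀ k → sign k ≈ constant (ε k)
sign≈constant k = go ∣ k ∣
  where
  go : ∀ m → (-ₛ 1ₛ) ^ₛ m ≈ constant (-1ℤ ℤ.^ m)
  go zero    = 1≈constant
  go (suc m) = ≈-trans (*ₛ-cong (pointwise λ { zero → refl ; (suc _) → refl }) (go m))
    (constant-* -1ℤ (-1ℤ ℤ.^ m))

q^≡δ : ∀ m n → q^ m n ≡ δ (+ m) n
q^≡δ m n with n ℕₚ.≟ m
... | yes refl rewrite dec-true (m ℕₚ.≟ m) refl = refl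
... | no n≢m rewrite dec-false (n ℕₚ.≟ m) n≢m = sym (δ-≢ {+ m} {n} (n≢m ∘ sym ∘ ℤₚ.+-injective))

coeff-monomial : ∀ c m {z} n → + m ≡ z → coeff (constant c *ₛ X ^ₛ m) n ≡ c ℤ.* δ z n
coeff-monomial c m n refl = trans (constant-⊛ c (coeff (X ^ₛ m)) n)
  (cong (c ℤ.*_) (trans (coeff-X^ m n) (q^≡δ m n)))

T : PowerSeries
T = φ⁻ (X ^ₛ 1) *ₛ φ⁻ (X ^ₛ 3)

P : PowerSeries
P = X *ₛ (ψ (X ^ₛ 2) *ₛ ψ (X ^ₛ 6))

quadratic : ℤ → ℤ → ℤ
quadratic s t = s ℤ.* s ℤ.+ 3ℤ ℤ.* (t ℤ.* t)

coeff-T : ∀ N {n} → n ℕ.≤ N →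
  coeff T n ≡ sumℤ N (λ s → sumℤ N (λ t → ε s ℤ.* ε t ℤ.* δ (quadratic s t) n))
coeff-T N {n} n≤N = begin
  coeff T n
    ≡⟨ at (*ₛ-identityˡ T) n ⟨
  coeff (1ₛ *ₛ T) n
    ≡⟨ coeff-*-sumℤ∞ (summable-φ⁻ {X ^ₛ 1} refl) (summable-φ⁻ {X ^ₛ 3} refl) 1ₛ n≤N n≤N ⟩
  sumℤ N (λ s → sumℤ N (λ t → coeff (1ₛ *ₛ (φ⁻-term (X ^ₛ 1) s *ₛ φ⁻-term (X ^ₛ 3) t)) n))
    ≡⟨ sumℤ-cong N (λ s → sumℤ-cong N (λ t →
         trans (at (term s t) n) (coeff-monomial (ε s ℤ.* ε t) _ n (exponent s t)))) ⟩
  _ ∎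
  where
  open ≡-Reasoning
  term : ∀ s t → 1ₛ *ₛ (φ⁻-term (X ^ₛ 1) s *ₛ φ⁻-term (X ^ₛ 3) t) ≈
                 constant (ε s ℤ.* ε t) *ₛ X ^ₛ (1 ℕ.* square s ℕ.+ 3 ℕ.* square t)
  term s t = R.begin
    1ₛ *ₛ (sign s *ₛ (X ^ₛ 1) ^ₛ square s *ₛ (sign t *ₛ (X ^ₛ 3) ^ₛ square t))
      R.≈⟨ solve 4 (λ a b c d → :1 :* (a :* b :* (c :* d)) := a :* c :* (b :* d)) ≈-refl
           (sign s) ((X ^ₛ 1) ^ₛ square s) (sign t) ((X ^ₛ 3) ^ₛ square t) ⟩
    sign s *ₛ sign t *ₛ ((X ^ₛ 1) ^ₛ square s *ₛ (X ^ₛ 3) ^ₛ square t)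
      R.≈⟨ *ₛ-cong (≈-trans (*ₛ-cong (sign≈constant s) (sign≈constant t)) (constant-* (ε s) (ε t)))
           (≈-trans (*ₛ-cong (^-assocʳ X 1 (square s)) (^-assocʳ X 3 (square t)))
             (≈-sym (^-homo-* X (1 ℕ.* square s) (3 ℕ.* square t)))) ⟩
    constant (ε s ℤ.* ε t) *ₛ X ^ₛ (1 ℕ.* square s ℕ.+ 3 ℕ.* square t) R.∎
    where
    open Solver
    module R = ≈-Reasoning
  exponent : ∀ s t → + (1 ℕ.* square s ℕ.+ 3 ℕ.* square t) ≡ quadratic s t
  exponent s t = cong₂ ℤ._+_ (trans (cong +_ (ℕₚ.*-identityˡ (square s))) (sym (i*i≡∣i∣*∣i∣ s)))
    (trans (ℤₚ.pos-* 3 (square t)) (cong (3ℤ ℤ.*_) (sym (i*i≡∣i∣*∣i∣ t))))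

+hexagonal : ∀ k → + hexagonal k ≡ 2ℤ ℤ.* (k ℤ.* k) ℤ.+ k
+hexagonal (+ n) = trans (ℤₚ.pos-* n (suc (2 ℕ.* n)))
  (trans (cong (λ z → + n ℤ.* (1ℤ ℤ.+ z)) (ℤₚ.pos-* 2 n)) (ring (+ n)))
  where
  ring : ∀ k → k ℤ.* (1ℤ ℤ.+ 2ℤ ℤ.* k) ≡ 2ℤ ℤ.* (k ℤ.* k) ℤ.+ k
  ring = ℤSolver.solve-∀
+hexagonal -[1+ n ] = trans (ℤₚ.pos-* (suc n) (suc (2 ℕ.* n)))
  (trans (cong (λ z → (1ℤ ℤ.+ + n) ℤ.* (1ℤ ℤ.+ z)) (ℤₚ.pos-* 2 n)) (ring (+ n)))
  where
  ring : ∀ k → (1ℤ ℤ.+ k) ℤ.* (1ℤ ℤ.+ 2ℤ ℤ.* k) ≡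
    2ℤ ℤ.* (- (1ℤ ℤ.+ k) ℤ.* - (1ℤ ℤ.+ k)) ℤ.+ - (1ℤ ℤ.+ k)
  ring = ℤSolver.solve-∀

hexagonalForm : ℤ → ℤ → ℤ
hexagonalForm a b =
  1ℤ ℤ.+ (2ℤ ℤ.* (2ℤ ℤ.* (a ℤ.* a) ℤ.+ a) ℤ.+ + 6 ℤ.* (2ℤ ℤ.* (b ℤ.* b) ℤ.+ b))

-- Two independent windows, because `lattice` ends with b in the window K and a in the larger window
-- N.
coeff-P : ∀ M N {n} → n ℕ.≤ M → n ℕ.≤ N →
  coeff P n ≡ sumℤ M (λ b → sumℤ N (λ a → δ (hexagonalForm a b) n))
coeff-P M N {n} n≤M n≤N = begin
  coeff P n
    ≡⟨ coeff-*-sumℤ∞ (summable-ψ {X ^ₛ 2} refl) (summable-ψ {X ^ₛ 6} refl) X n≤N n≤M ⟩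
  sumℤ N (λ a → sumℤ M (λ b → coeff (X *ₛ (ψ-term (X ^ₛ 2) a *ₛ ψ-term (X ^ₛ 6) b)) n))
    ≡⟨ sumℤ-comm _ N M ⟩
  sumℤ M (λ b → sumℤ N (λ a → coeff (X *ₛ (ψ-term (X ^ₛ 2) a *ₛ ψ-term (X ^ₛ 6) b)) n))
    ≡⟨ sumℤ-cong M (λ b → sumℤ-cong N (λ a → trans (at (term a b) n)
         (trans (coeff-monomial 1ℤ _ n (exponent a b)) (ℤₚ.*-identityˡ _)))) ⟩
  _ ∎
  where
  open ≡-Reasoning
  term : ∀ a b → X *ₛ (ψ-term (X ^ₛ 2) a *ₛ ψ-term (X ^ₛ 6) b) ≈
                 constant 1ℤ *ₛ X ^ₛ suc (2 ℕ.* hexagonal a ℕ.+ 6 ℕ.* hexagonal b)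
  term a b = R.begin
    X *ₛ ((X ^ₛ 2) ^ₛ hexagonal a *ₛ (X ^ₛ 6) ^ₛ hexagonal b)
      R.≈⟨ *ₛ-congˡ (*ₛ-cong (^-assocʳ X 2 (hexagonal a)) (^-assocʳ X 6 (hexagonal b))) ⟩
    X *ₛ (X ^ₛ (2 ℕ.* hexagonal a) *ₛ X ^ₛ (6 ℕ.* hexagonal b))
      R.≈⟨ *ₛ-congˡ (^-homo-* X (2 ℕ.* hexagonal a) (6 ℕ.* hexagonal b)) ⟨
    X ^ₛ suc (2 ℕ.* hexagonal a ℕ.+ 6 ℕ.* hexagonal b)
      R.≈⟨ *ₛ-identityˡ _ ⟨
    1ₛ *ₛ X ^ₛ suc (2 ℕ.* hexagonal a ℕ.+ 6 ℕ.* hexagonal b)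
      R.≈⟨ *ₛ-congʳ 1≈constant ⟩
    constant 1ℤ *ₛ X ^ₛ suc (2 ℕ.* hexagonal a ℕ.+ 6 ℕ.* hexagonal b) R.∎
    where module R = ≈-Reasoning
  exponent : ∀ a b → + suc (2 ℕ.* hexagonal a ℕ.+ 6 ℕ.* hexagonal b) ≡ hexagonalForm a b
  exponent a b = cong (λ z → 1ℤ ℤ.+ z) (cong₂ ℤ._+_
    (trans (ℤₚ.pos-* 2 (hexagonal a)) (cong (2ℤ ℤ.*_) (+hexagonal a)))
    (trans (ℤₚ.pos-* 6 (hexagonal b)) (cong (+ 6 ℤ.*_) (+hexagonal b))))

Parity : ℤ → ℤ → Set
Parity k e = ∃[ i ] ((k ≡ 2ℤ ℤ.* i × e ≡ 1ℤ) ⊎ (k ≡ 1ℤ ℤ.+ 2ℤ ℤ.* i × e ≡ -1ℤ))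

parity : ∀ k → Parity k (ε k)
parity (+ n) = parity⁺ n
  where
  ring : ∀ i → 1ℤ ℤ.+ (1ℤ ℤ.+ 2ℤ ℤ.* i) ≡ 2ℤ ℤ.* (1ℤ ℤ.+ i)
  ring = ℤSolver.solve-∀
  parity⁺ : ∀ n → Parity (+ n) (ε (+ n))
  parity⁺ zero    = 0ℤ , inj₁ (refl , refl)
  parity⁺ (suc n) with parity⁺ n
  ... | i , inj₁ (e , s) = i , inj₂ (cong (λ z → 1ℤ ℤ.+ z) e , cong (-1ℤ ℤ.*_) s)
  ... | i , inj₂ (e , s) = 1ℤ ℤ.+ i , inj₁
    (trans (cong (λ z → 1ℤ ℤ.+ z) e) (ring i) , cong (-1ℤ ℤ.*_) s)
parity -[1+ n ] with parity (+ suc n)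
... | i , inj₁ (e , s) = - i , inj₁ (trans (cong -_ e) (ring i) , s)
  where
  ring : ∀ i → - (2ℤ ℤ.* i) ≡ 2ℤ ℤ.* - i
  ring = ℤSolver.solve-∀
... | i , inj₂ (e , s) = -1ℤ - i , inj₂ (trans (cong -_ e) (ring i) , s)
  where
  ring : ∀ i → - (1ℤ ℤ.+ 2ℤ ℤ.* i) ≡ 1ℤ ℤ.+ 2ℤ ℤ.* (-1ℤ - i)
  ring = ℤSolver.solve-∀

even≢odd : ∀ w i → 2ℤ ℤ.* w ≢ 1ℤ ℤ.+ 2ℤ ℤ.* i
even≢odd w i e = 2m≢1 ∣ w - i ∣ (trans (sym (ℤₚ.abs-* 2ℤ (w - i))) (cong ∣_∣ (begin
  2ℤ ℤ.* (w - i)                    ≡⟨ ring w i ⟩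
  2ℤ ℤ.* w - 2ℤ ℤ.* i               ≡⟨ cong (_- 2ℤ ℤ.* i) e ⟩
  1ℤ ℤ.+ 2ℤ ℤ.* i - 2ℤ ℤ.* i        ≡⟨ ring′ i ⟩
  1ℤ                                ∎)))
  where
  open ≡-Reasoning
  ring : ∀ w i → 2ℤ ℤ.* (w - i) ≡ 2ℤ ℤ.* w - 2ℤ ℤ.* i
  ring = ℤSolver.solve-∀
  ring′ : ∀ i → 1ℤ ℤ.+ 2ℤ ℤ.* i - 2ℤ ℤ.* i ≡ 1ℤ
  ring′ = ℤSolver.solve-∀
  2m≢1 : ∀ m → 2 ℕ.* m ≢ 1
  2m≢1 (suc m) e with () ← trans (sym (ℕₚ.*-suc 2 m)) e

-- Squares are 0 or 1 modulo 4. Hence equal parities give 0 or 1 + 3, and the sign 1; opposite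
-- parities give an odd value and the sign -1. So parity of the exponent separates the positive from
-- the negative terms of `T`.
quadratic-parity : ∀ s t → ∃[ w ] ((quadratic s t ≡ 4ℤ ℤ.* w × ε s ℤ.* ε t ≡ 1ℤ)
                              ⊎ (quadratic s t ≡ 1ℤ ℤ.+ 2ℤ ℤ.* w × ε s ℤ.* ε t ≡ -1ℤ))
quadratic-parity s t with parity s | parity t
... | i , inj₁ (refl , e) | j , inj₁ (refl , e′) = _ , inj₁ (ring i j , cong₂ ℤ._*_ e e′)
  where
  ring : ∀ i j → 2ℤ ℤ.* i ℤ.* (2ℤ ℤ.* i) ℤ.+ 3ℤ ℤ.* (2ℤ ℤ.* j ℤ.* (2ℤ ℤ.* j)) ≡
                 4ℤ ℤ.* (i ℤ.* i ℤ.+ 3ℤ ℤ.* (j ℤ.* j))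
  ring = ℤSolver.solve-∀
... | i , inj₁ (refl , e) | j , inj₂ (refl , e′) =
  1ℤ ℤ.+ 2ℤ ℤ.* (i ℤ.* i) ℤ.+ + 6 ℤ.* (j ℤ.+ j ℤ.* j) , inj₂ (ring i j , cong₂ ℤ._*_ e e′)
  where
  ring : ∀ i j → let t = 1ℤ ℤ.+ 2ℤ ℤ.* j in
    2ℤ ℤ.* i ℤ.* (2ℤ ℤ.* i) ℤ.+ 3ℤ ℤ.* (t ℤ.* t) ≡
    1ℤ ℤ.+ 2ℤ ℤ.* (1ℤ ℤ.+ 2ℤ ℤ.* (i ℤ.* i) ℤ.+ + 6 ℤ.* (j ℤ.+ j ℤ.* j))
  ring = ℤSolver.solve-∀
... | i , inj₂ (refl , e) | j , inj₁ (refl , e′) =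
  2ℤ ℤ.* (i ℤ.+ i ℤ.* i) ℤ.+ + 6 ℤ.* (j ℤ.* j) , inj₂ (ring i j , cong₂ ℤ._*_ e e′)
  where
  ring : ∀ i j → let s = 1ℤ ℤ.+ 2ℤ ℤ.* i in
    s ℤ.* s ℤ.+ 3ℤ ℤ.* (2ℤ ℤ.* j ℤ.* (2ℤ ℤ.* j)) ≡
    1ℤ ℤ.+ 2ℤ ℤ.* (2ℤ ℤ.* (i ℤ.+ i ℤ.* i) ℤ.+ + 6 ℤ.* (j ℤ.* j))
  ring = ℤSolver.solve-∀
... | i , inj₂ (refl , e) | j , inj₂ (refl , e′) = _ , inj₁ (ring i j , cong₂ ℤ._*_ e e′)
  where
  ring : ∀ i j → let s = 1ℤ ℤ.+ 2ℤ ℤ.* i ; t = 1ℤ ℤ.+ 2ℤ ℤ.* j in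
    s ℤ.* s ℤ.+ 3ℤ ℤ.* (t ℤ.* t) ≡
    4ℤ ℤ.* (1ℤ ℤ.+ (i ℤ.+ i ℤ.* i) ℤ.+ 3ℤ ℤ.* (j ℤ.+ j ℤ.* j))
  ring = ℤSolver.solve-∀

-- The even part of T; its odd part is -2 P.
Ev : PowerSeries
Ev = T +ₛ (P +ₛ P)

-- The sign patterns +, 0, -, 0 and +, 0, 0, 0, and the even part of φ(-q) φ(-q³)

χ₂ : ℕ → ℤ
χ₂ 0             = 1ℤ
χ₂ 1             = 0ℤ
χ₂ (suc (suc n)) = - χ₂ n

χ₂-* : ∀ i j → ∃[ e ] χ₂ i ℤ.* χ₂ j ≡ χ₂ (i ℕ.+ j) ℤ.* + e
χ₂-* 0             j = 1 , ℤₚ.*-comm 1ℤ (χ₂ j)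
χ₂-* 1             j = 0 , sym (ℤₚ.*-zeroʳ (χ₂ (suc j)))
χ₂-* (suc (suc i)) j with e , χχ ← χ₂-* i j = e , trans (sym (ℤₚ.neg-distribˡ-* (χ₂ i) (χ₂ j)))
  (trans (cong -_ χχ) (ℤₚ.neg-distribˡ-* (χ₂ (i ℕ.+ j)) (+ e)))

module Alternating = Cone χ₂ refl χ₂-*

χ₂-4* : ∀ m → χ₂ (4 ℕ.* m) ≡ 1ℤ
χ₂-4* m = trans (cong χ₂ (ℕₚ.*-comm 4 m)) (go m)
  where
  go : ∀ m → χ₂ (m ℕ.* 4) ≡ 1ℤ
  go zero    = refl
  go (suc m) = trans (ℤₚ.neg-involutive _) (go m)

module _ where
  open Alternating

  graded-sumℤ : ∀ {n h} N → (∀ k → Graded n (h k)) → Graded n (sumℤ N h)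
  graded-sumℤ zero    h∈ = h∈ 0ℤ
  graded-sumℤ (suc N) h∈ = graded-+ (graded-sumℤ N h∈) (graded-+ (h∈ (+ suc N)) (h∈ -[1+ N ]))

  -- For even n the series `P` contributes nothing, and the surviving terms of `T` are +1 at
  -- multiples of 4, where `χ₂` is 1. For odd n, where `χ₂` is 0, all terms of `T` are negative and
  -- `lattice` cancels them against 2 `P`.
  cone-Ev : InCone Ev
  cone-Ev = inCone go
    where
    open ≡-Reasoning
    go : ∀ n → Graded n (coeff Ev n)
    go n with parity (+ n)
    ... | i , inj₁ (n≡2i , _) = graded-+
      (subst (Graded n) (sym (coeff-T n ℕₚ.≤-refl))
        (graded-sumℤ n λ s → graded-sumℤ n λ t → term s t))
      (subst (Graded n) (sym (cong₂ ℤ._+_ P≡0 P≡0)) (graded-0 n))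
      where
      odd≢n : ∀ w → 1ℤ ℤ.+ 2ℤ ℤ.* w ≢ + n
      odd≢n w e = even≢odd i w (trans (sym n≡2i) (sym e))
      P≡0 : coeff P n ≡ 0ℤ
      P≡0 = trans (coeff-P n n ℕₚ.≤-refl ℕₚ.≤-refl) (sumℤ-0 n λ b → sumℤ-0 n λ a →
        δ-≢ (λ e → odd≢n (2ℤ ℤ.* (a ℤ.* a) ℤ.+ a ℤ.+ 3ℤ ℤ.* (2ℤ ℤ.* (b ℤ.* b) ℤ.+ b)) (trans (ring a b) e)))
        where
        ring : ∀ a b →
          1ℤ ℤ.+ 2ℤ ℤ.* (2ℤ ℤ.* (a ℤ.* a) ℤ.+ a ℤ.+ 3ℤ ℤ.* (2ℤ ℤ.* (b ℤ.* b) ℤ.+ b)) ≡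
          1ℤ ℤ.+ (2ℤ ℤ.* (2ℤ ℤ.* (a ℤ.* a) ℤ.+ a) ℤ.+ + 6 ℤ.* (2ℤ ℤ.* (b ℤ.* b) ℤ.+ b))
        ring = ℤSolver.solve-∀
      zero-term : ∀ c {z} → z ≢ + n → Graded n (c ℤ.* δ z n)
      zero-term c z≢n = subst (Graded n)
        (sym (trans (cong (c ℤ.*_) (δ-≢ z≢n)) (ℤₚ.*-zeroʳ c))) (graded-0 n)
      term : ∀ s t → Graded n (ε s ℤ.* ε t ℤ.* δ (quadratic s t) n)
      term s t with quadratic-parity s t
      ... | w , inj₂ (e , _) = zero-term (ε s ℤ.* ε t) (λ e′ → odd≢n w (trans (sym e) e′))
      ... | w , inj₁ (e , εε) with quadratic s t ℤₚ.≟ + n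
      ...   | no  z≢n = multiple 0 (trans (ℤₚ.*-zeroʳ (ε s ℤ.* ε t)) (sym (ℤₚ.*-zeroʳ (χ₂ n))))
      ...   | yes z≡n = multiple 1 (cong (ℤ._* 1ℤ) (trans εε (sym χ≡1)))
        where
        χ≡1 : χ₂ n ≡ 1ℤ
        χ≡1 = trans (cong χ₂ (trans (cong ∣_∣ (trans (sym z≡n) e)) (ℤₚ.abs-* 4ℤ w))) (χ₂-4* ∣ w ∣)
    ... | i , inj₂ (n≡1+2i , _) = subst (Graded n) (sym (begin
      coeff T n ℤ.+ (coeff P n ℤ.+ coeff P n)
        ≡⟨ cong₂ ℤ._+_ (trans (coeff-T N n≤N) T≡) (cong₂ ℤ._+_ (coeff-P K N n≤K n≤N) (coeff-P K N n≤K n≤N)) ⟩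
      - (2ℤ ℤ.* S) ℤ.+ (S ℤ.+ S)
        ≡⟨ ring S ⟩
      0ℤ ∎)) (graded-0 n)
      where
      n-odd : ∀ w → 2ℤ ℤ.* w ≢ + n
      n-odd w e = even≢odd w i (trans e n≡1+2i)
      K = suc (suc (suc (4 ℕ.* n)))
      open Lattice n n-odd K ℕₚ.≤-refl
      n≤N : n ℕ.≤ N
      n≤N = ℕₚ.≤-trans n≤K (ℕₚ.≤-trans (ℕₚ.m≤m+n K K) (ℕₚ.<⇒≤ K+K<N))
      S = sumℤ K (λ b → sumℤ N (λ a → δ (hexagonalForm a b) n))
      ring : ∀ S → - (2ℤ ℤ.* S) ℤ.+ (S ℤ.+ S) ≡ 0ℤ
      ring = ℤSolver.solve-∀
      term : ∀ s t → ε s ℤ.* ε t ℤ.* δ (quadratic s t) n ≡ - δ (quadratic s t) n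
      term s t with quadratic-parity s t
      ... | w , inj₁ (e , εε) = trans
        (cong (ε s ℤ.* ε t ℤ.*_) δ≡0) (trans (ℤₚ.*-zeroʳ (ε s ℤ.* ε t)) (cong -_ (sym δ≡0)))
        where
        four : ∀ w → 2ℤ ℤ.* (2ℤ ℤ.* w) ≡ 4ℤ ℤ.* w
        four = ℤSolver.solve-∀
        δ≡0 : δ (quadratic s t) n ≡ 0ℤ
        δ≡0 = δ-≢ (λ e′ → n-odd (2ℤ ℤ.* w) (trans (four w) (trans (sym e) e′)))
      ... | w , inj₂ (_ , εε) = trans (cong (ℤ._* δ (quadratic s t) n) εε) (ℤₚ.-1*i≡-i _)
      T≡ : sumℤ N (λ s → sumℤ N (λ t → ε s ℤ.* ε t ℤ.* δ (quadratic s t) n)) ≡ - (2ℤ ℤ.* S)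
      T≡ = begin
        sumℤ N (λ s → sumℤ N (λ t → ε s ℤ.* ε t ℤ.* δ (quadratic s t) n))
          ≡⟨ sumℤ-cong N (λ s → trans (sumℤ-cong N (term s)) (sumℤ-neg _ N)) ⟩
        sumℤ N (λ s → - sumℤ N (λ t → δ (quadratic s t) n))
          ≡⟨ sumℤ-neg _ N ⟩
        - sumℤ N (λ s → sumℤ N (λ t → δ (quadratic s t) n))
          ≡⟨ cong -_ lattice ⟩
        - (2ℤ ℤ.* S) ∎

χ₄ : ℕ → ℤ
χ₄ 0                         = 1ℤ
χ₄ 1                         = 0ℤ
χ₄ 2                         = 0ℤ
χ₄ 3                         = 0ℤ
χ₄ (suc (suc (suc (suc n)))) = χ₄ n

χ₄-* : ∀ i j → ∃[ e ] χ₄ i ℤ.* χ₄ j ≡ χ₄ (i ℕ.+ j) ℤ.* + e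
χ₄-* 0                         j = 1 , ℤₚ.*-comm 1ℤ (χ₄ j)
χ₄-* 1                         j = 0 , sym (ℤₚ.*-zeroʳ (χ₄ (1 ℕ.+ j)))
χ₄-* 2                         j = 0 , sym (ℤₚ.*-zeroʳ (χ₄ (2 ℕ.+ j)))
χ₄-* 3                         j = 0 , sym (ℤₚ.*-zeroʳ (χ₄ (3 ℕ.+ j)))
χ₄-* (suc (suc (suc (suc i)))) j = χ₄-* i j

module Fourth = Cone χ₄ refl χ₄-*

-- Σ χ n qⁿ is 1/(1+q²) for χ = χ₂ and 1/(1-q⁴) for χ = χ₄.
G₂ G₄ : PowerSeries
G₂ = series χ₂
G₄ = series χ₄

G₂-spec : G₂ *ₛ (1ₛ -ₛ X ^ₛ 4) ≈ 1ₛ -ₛ X ^ₛ 2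
G₂-spec = begin
  G₂ *ₛ (1ₛ -ₛ X ^ₛ 4)
    ≈⟨ solve 2 (λ g x → g :* (:1 :- x :* (x :* (x :* (x :* :1)))) :=
                       (g :+ x :* (x :* g)) :* (:1 :- x :* (x :* :1))) ≈-refl G₂ X ⟩
  (G₂ +ₛ X *ₛ (X *ₛ G₂)) *ₛ (1ₛ -ₛ X ^ₛ 2)
    ≈⟨ *ₛ-congʳ one ⟩
  1ₛ *ₛ (1ₛ -ₛ X ^ₛ 2)
    ≈⟨ *ₛ-identityˡ _ ⟩
  1ₛ -ₛ X ^ₛ 2  ∎
  where
  open Solver
  open ≈-Reasoning
  one : G₂ +ₛ X *ₛ (X *ₛ G₂) ≈ 1ₛ
  one = pointwise λ
    { 0             → refl
    ; 1             → cong (λ z → 0ℤ ℤ.+ z) (coeff-X* (X *ₛ G₂) 0)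
    ; (suc (suc n)) → trans (cong (λ z → - χ₂ n ℤ.+ z)
        (trans (coeff-X* (X *ₛ G₂) (suc n)) (coeff-X* G₂ n))) (ℤₚ.+-inverseˡ (χ₂ n)) }

G₄-spec : (1ₛ -ₛ X ^ₛ 4) *ₛ G₄ ≈ 1ₛ
G₄-spec = begin
  (1ₛ -ₛ X ^ₛ 4) *ₛ G₄
    ≈⟨ solve 2 (λ g x → (:1 :- x :* (x :* (x :* (x :* :1)))) :* g :=
                       g :- x :* (x :* (x :* (x :* g)))) ≈-refl G₄ X ⟩
  G₄ -ₛ X *ₛ (X *ₛ (X *ₛ (X *ₛ G₄)))
    ≈⟨ pointwise (λ
      { 0 → refl
      ; 1 → cong (λ z → 0ℤ ℤ.+ - z) (coeff-X* (X *ₛ (X *ₛ (X *ₛ G₄))) 0)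
      ; 2 → cong (λ z → 0ℤ ℤ.+ - z) (trans (coeff-X* (X *ₛ (X *ₛ (X *ₛ G₄))) 1) (coeff-X* (X *ₛ (X *ₛ G₄)) 0))
      ; 3 → cong (λ z → 0ℤ ℤ.+ - z) (trans (coeff-X* (X *ₛ (X *ₛ (X *ₛ G₄))) 2)
              (trans (coeff-X* (X *ₛ (X *ₛ G₄)) 1) (coeff-X* (X *ₛ G₄) 0)))
      ; (suc (suc (suc (suc n)))) → trans (cong (λ z → χ₄ n ℤ.+ - z)
          (trans (coeff-X* (X *ₛ (X *ₛ (X *ₛ G₄))) (3 + n)) (trans (coeff-X* (X *ₛ (X *ₛ G₄)) (2 + n))
            (trans (coeff-X* (X *ₛ G₄) (1 + n)) (coeff-X* G₄ n))))) (ℤₚ.+-inverseʳ (χ₄ n)) }) ⟩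
  1ₛ  ∎
  where
  open Solver
  open ≈-Reasoning

-- Signs of f₁₂² / f₄ and of Ev f₂ f₆ / f₄³

module C = Cauchy (X ^ₛ 12) (X ^ₛ 8) (X ^ₛ 4) (≈-sym (^-homo-* X 8 4)) refl refl

M₄ M₈ : PowerSeries
M₄ = Π∞ C.β
M₈ = Π∞ C.ξ

unital-ξ : Unital C.ξ
unital-ξ = C.unital-ξ refl

E : ℕ → PowerSeries
E d = euler (X ^ₛ d)

odd-factor even-factor : ℕ → ℕ → PowerSeries
odd-factor d k = 1ₛ -ₛ X ^ₛ d *ₛ (X ^ₛ d *ₛ X ^ₛ d) ^ₛ k
even-factor d k = 1ₛ -ₛ (X ^ₛ d) ^ₛ suc k

unital-odd : ∀ d → coeff (X ^ₛ d) 0 ≡ 0ℤ → Unital (odd-factor d)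
unital-odd d X₀ k = ≈[]-trans (+ₛ-cong[] ≈[]-refl (-ₛ-cong[] (*ₛ-order-suc X₀
  (^ₛ-order k (cong (λ z → z ℤ.* z ℤ.+ 0ℤ) X₀))))) (≈⇒≈[] 1-0)

unital-even : ∀ d → coeff (X ^ₛ d) 0 ≡ 0ℤ → Unital (even-factor d)
unital-even d X₀ k = ≈[]-trans (+ₛ-cong[] ≈[]-refl (-ₛ-cong[] (^ₛ-order (suc k) X₀))) (≈⇒≈[] 1-0)

-- The multiples of 4 are sorted by their residues 4, 8, 0 modulo 12, three consecutive factors
-- forming a block.
E₄-split : E 4 ≈ M₄ *ₛ M₈ *ₛ E 12
E₄-split = begin
  E 4                                         ≈⟨ Π∞-blocks 3 (unital-even 4 refl) blocks ⟨
  Π∞ (λ k → C.β k *ₛ C.ξ k *ₛ C.α k)          ≈⟨ Π∞-* (Unital-* C.unital-β unital-ξ) C.unital-α ⟩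
  Π∞ (λ k → C.β k *ₛ C.ξ k) *ₛ E 12           ≈⟨ *ₛ-congʳ (Π∞-* C.unital-β unital-ξ) ⟩
  M₄ *ₛ M₈ *ₛ E 12                            ∎
  where
  open Solver
  open ≈-Reasoning
  q = X ^ₛ 4
  u : ℕ → PowerSeries
  u = even-factor 4
  power : ∀ k → (X ^ₛ 12) ^ₛ k ≈ q ^ₛ (3 * k)
  power k = ≈-trans (^-congˡ k (≈-sym (^-assocʳ X 4 3))) (^-assocʳ q 3 k)
  blocks : ∀ N → Π (λ k → C.β k *ₛ C.ξ k *ₛ C.α k) N ≈ Π u (3 * N)
  blocks zero    = ≈-refl
  blocks (suc N) = begin
    C.β N *ₛ C.ξ N *ₛ C.α N *ₛ Π (λ k → C.β k *ₛ C.ξ k *ₛ C.α k) N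
      ≈⟨ *ₛ-cong (*ₛ-cong (*ₛ-cong
           (-ₛ-cong₂ ≈-refl (*ₛ-congˡ (power N)))
           (-ₛ-cong₂ ≈-refl (≈-trans (*ₛ-cong (≈-sym (^-assocʳ X 4 2)) (power N)) (≈-sym (^-homo-* q 2 (3 * N))))))
           (-ₛ-cong₂ ≈-refl (≈-trans (power (suc N)) (^ₛ-≡ q (ℕₚ.*-suc 3 N)))))
           (blocks N) ⟩
    u (3 * N) *ₛ u (1 + 3 * N) *ₛ u (2 + 3 * N) *ₛ Π u (3 * N)
      ≈⟨ solve 4 (λ a b c P → a :* b :* c :* P := c :* (b :* (a :* P))) ≈-refl
           (u (3 * N)) (u (1 + 3 * N)) (u (2 + 3 * N)) (Π u (3 * N)) ⟩
    Π u (3 + 3 * N)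
      ≈⟨ Π-≡ u (ℕₚ.*-suc 3 N) ⟨
    Π u (3 * suc N)  ∎

i₄ i₈ : PowerSeries
i₄ = Π∞ (inv ∘ C.β)
i₈ = Π∞ (inv ∘ C.ξ)

-- f₁₂² / f₄
K : PowerSeries
K = i₄ *ₛ i₈ *ₛ E 12

M₄M₈K : M₄ *ₛ M₈ *ₛ K ≈ E 12
M₄M₈K = begin
  M₄ *ₛ M₈ *ₛ (i₄ *ₛ i₈ *ₛ E 12)
    ≈⟨ solve 5 (λ a b c d e → a :* b :* (c :* d :* e) := a :* c :* (b :* d) :* e) ≈-refl M₄ M₈ i₄ i₈ (E 12) ⟩
  M₄ *ₛ i₄ *ₛ (M₈ *ₛ i₈) *ₛ E 12
    ≈⟨ *ₛ-congʳ (*ₛ-cong (Π∞-inv C.unital-β) (Π∞-inv unital-ξ)) ⟩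
  1ₛ *ₛ 1ₛ *ₛ E 12
    ≈⟨ solve 1 (λ e → :1 :* :1 :* e := e) ≈-refl (E 12) ⟩
  E 12 ∎
  where
  open Solver
  open ≈-Reasoning

K-spec : K *ₛ E 4 ≈ E 12 *ₛ E 12
K-spec = begin
  K *ₛ E 4                  ≈⟨ *ₛ-congˡ E₄-split ⟩
  K *ₛ (M₄ *ₛ M₈ *ₛ E 12)   ≈⟨ solve 4 (λ k a b c → k :* (a :* b :* c) := a :* b :* k :* c) ≈-refl K M₄ M₈ (E 12) ⟩
  M₄ *ₛ M₈ *ₛ K *ₛ E 12     ≈⟨ *ₛ-congʳ M₄M₈K ⟩
  E 12 *ₛ E 12              ∎
  where
  open Solver
  open ≈-Reasoning

-- The partial sums of `G₄`, to be compared with `V` term by term: they keep only y^s of its s-th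
-- summand.
geometric : ℕ → PowerSeries
geometric zero    = 0ₛ
geometric (suc N) = geometric N +ₛ (X ^ₛ 4) ^ₛ N

geometric-limit : ∀ N → G₄ ≈[ N ] geometric N
geometric-limit N = *ₛ-cancelˡ[] {1ₛ -ₛ X ^ₛ 4} refl (≈[]-trans (≈⇒≈[] G₄-spec) (≈[]-sym
  (≈[]-trans (≈⇒≈[] (telescope N)) (≈[]-trans (+ₛ-cong[] ≈[]-refl (-ₛ-cong[] (^ₛ-order N refl))) (≈⇒≈[] 1-0)))))
  where
  open Solver
  telescope : ∀ N → (1ₛ -ₛ X ^ₛ 4) *ₛ geometric N ≈ 1ₛ -ₛ (X ^ₛ 4) ^ₛ N
  telescope zero    = solve 1 (λ y → (:1 :- y) :* :0 := :1 :- :1) ≈-refl (X ^ₛ 4)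
  telescope (suc N) = ≈-trans (distribˡ _ _ _) (≈-trans (+ₛ-congʳ (telescope N))
    (solve 2 (λ y z → :1 :- z :+ (:1 :- y) :* z := :1 :- y :* z) ≈-refl (X ^ₛ 4) ((X ^ₛ 4) ^ₛ N)))

module _ where
  open Fourth

  -- `K` exceeds 1/(1 - q⁴) by a series with coefficients ≥ 0 at multiples of 4 and 0 elsewhere:
  -- each summand y^s / ((p;p)_s (x p^s;p)_∞) is y^s times a series with constant term 1.
  strict-K : Strict K
  strict-K = strict-≈ (solve 2 (λ g k → g :+ (k :- g) := k) ≈-refl G₄ K)
    (strict-+ (mkStrict λ n → 0 , sym (ℤₚ.*-identityʳ (χ₄ n))) (inCone λ n →
      subst (Graded n) (sym (cong₂ (λ x y → x ℤ.+ - y)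
        (at-below (C.V-limit refl {K} (≈-sym M₄M₈K) n) (ℕₚ.n<1+n n))
        (at-below (geometric-limit (suc n)) (ℕₚ.n<1+n n))))
      (graded (cone-V-geometric (suc n)) n)))
    where
    open Solver
    V = C.V refl
    cone-y : InCone (X ^ₛ 4)
    cone-y = cone-X^ 4 refl
    cone-p : ∀ k → InCone ((X ^ₛ 12) ^ₛ k)
    cone-p k = cone-^ k (cone-X^ 12 refl)
    cone-iξ : ∀ k → InCone (inv (C.ξ k))
    cone-iξ k = cone-inv refl (cone-* (cone-X^ 8 refl) (cone-p k))
    A : ℕ → PowerSeries
    A = Π (inv ∘ C.α)
    cone-A : ∀ N → InCone (A N)
    cone-A = cone-Π (λ k → cone-inv refl (cone-p (suc k)))
    A₀≡1 : ∀ N → coeff (A N) 0 ≡ 1ℤ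
    A₀≡1 zero    = refl
    A₀≡1 (suc N) = coeff-*₀ {inv (C.α N)} {A N} refl (A₀≡1 N)
    cone-yA : ∀ N → InCone ((X ^ₛ 4) ^ₛ N *ₛ A N)
    cone-yA N = cone-* (cone-^ N cone-y) (cone-A N)
    cone-V : ∀ N → InCone (V N)
    cone-V zero    = inCone graded-0
    cone-V (suc N) = cone-* (cone-iξ N) (cone-+ (cone-V N) (cone-yA N))
    cone-V-geometric : ∀ N → InCone (V N -ₛ geometric N)
    cone-V-geometric zero    = inCone graded-0
    cone-V-geometric (suc N) = cone-≈
      -- With i = 1/(1 - x p^N) and a = 1/(p;p)_N, both of constant term 1, everything new in the
      -- difference contains i - 1 or a - 1. The variable y stands for the power q^(4N).
      (solve 5 (λ i v y a g → (i :- :1) :* (v :+ y :* a) :+ (v :- g) :+ y :* (a :- :1) :=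
                              i :* (v :+ y :* a) :- (g :+ y)) ≈-refl
         (inv (C.ξ N)) (V N) ((X ^ₛ 4) ^ₛ N) (A N) (geometric N))
      (cone-+ (cone-+ (cone-* (cone-minus-1 (cone-iξ N) refl) (cone-+ (cone-V N) (cone-yA N)))
        (cone-V-geometric N)) (cone-* (cone-^ N cone-y) (cone-minus-1 (cone-A N) (A₀≡1 N))))

O : ℕ → PowerSeries
O d = eulerOdd (X ^ₛ d)

-- The first factors are kept apart, because (1 - q²)/(1 - q⁴) has to become `G₂`, the source of
-- strictness.
O₂′ e₄′ i₄′ : PowerSeries
O₂′ = Π∞ (odd-factor 2 ∘ suc)
e₄′ = Π∞ (even-factor 4 ∘ suc)
i₄′ = Π∞ (inv ∘ even-factor 4 ∘ suc)

-- H = Ev f₂ f₆ / f₄³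
B H : PowerSeries
B = Ev *ₛ O₂′ *ₛ O 6 *ₛ i₄′ *ₛ i₄ *ₛ i₈
H = G₂ *ₛ B

-- From f₂ = (q²;q⁴)_∞ f₄, f₆ = (q⁶;q¹²)_∞ f₁₂ and `E₄-split` it follows that f₂ f₆ / f₄³ =
-- (q²;q⁴)_∞ (q⁶;q¹²)_∞ / (f₄ M₄ M₈), where f₁₂ has cancelled; this is the form with denominators
-- cleared.
H-spec : H *ₛ E 4 *ₛ (M₄ *ₛ M₈) ≈ O 2 *ₛ O 6 *ₛ Ev
H-spec = begin
  H *ₛ E 4 *ₛ (M₄ *ₛ M₈)
    ≈⟨ *ₛ-congʳ (*ₛ-congˡ (≈-trans (Π∞-head (unital-even 4 refl)) (*ₛ-congʳ first₄))) ⟩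
  G₂ *ₛ (Ev *ₛ O₂′ *ₛ O 6 *ₛ i₄′ *ₛ i₄ *ₛ i₈) *ₛ ((1ₛ -ₛ X ^ₛ 4) *ₛ e₄′) *ₛ (M₄ *ₛ M₈)
    ≈⟨ solve 11 (λ g v o₂ o₆ j a b w t m n →
         g :* (v :* o₂ :* o₆ :* j :* a :* b) :* (w :* t) :* (m :* n) :=
         g :* w :* (t :* j) :* (m :* a) :* (n :* b) :* (o₂ :* o₆ :* v)) ≈-refl
         G₂ Ev O₂′ (O 6) i₄′ i₄ i₈ (1ₛ -ₛ X ^ₛ 4) e₄′ M₄ M₈ ⟩
  G₂ *ₛ (1ₛ -ₛ X ^ₛ 4) *ₛ (e₄′ *ₛ i₄′) *ₛ (M₄ *ₛ i₄) *ₛ (M₈ *ₛ i₈) *ₛ (O₂′ *ₛ O 6 *ₛ Ev)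
    ≈⟨ *ₛ-congʳ (*ₛ-cong (*ₛ-cong (*ₛ-cong G₂-spec (Π∞-inv (Unital-tail (unital-even 4 refl))))
         (Π∞-inv C.unital-β)) (Π∞-inv unital-ξ)) ⟩
  (1ₛ -ₛ X ^ₛ 2) *ₛ 1ₛ *ₛ 1ₛ *ₛ 1ₛ *ₛ (O₂′ *ₛ O 6 *ₛ Ev)
    ≈⟨ solve 4 (λ w o₂ o₆ v → w :* :1 :* :1 :* :1 :* (o₂ :* o₆ :* v) := w :* o₂ :* o₆ :* v) ≈-refl
         (1ₛ -ₛ X ^ₛ 2) O₂′ (O 6) Ev ⟩
  (1ₛ -ₛ X ^ₛ 2) *ₛ O₂′ *ₛ O 6 *ₛ Ev
    ≈⟨ *ₛ-congʳ (*ₛ-congʳ (≈-trans (*ₛ-congʳ first₂) (≈-sym (Π∞-head (unital-odd 2 refl))))) ⟩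
  O 2 *ₛ O 6 *ₛ Ev ∎
  where
  open Solver
  open ≈-Reasoning
  first₄ : even-factor 4 0 ≈ 1ₛ -ₛ X ^ₛ 4
  first₄ = -ₛ-cong₂ ≈-refl (*ₛ-identityʳ (X ^ₛ 4))
  first₂ : 1ₛ -ₛ X ^ₛ 2 ≈ odd-factor 2 0
  first₂ = -ₛ-cong₂ ≈-refl (≈-sym (*ₛ-identityʳ (X ^ₛ 2)))

module _ where
  open Alternating

  strict-H : Strict H
  strict-H = strict-* (mkStrict λ n → 0 , sym (ℤₚ.*-identityʳ (χ₂ n)))
    (cone-* (cone-* (cone-* (cone-* (cone-* cone-Ev
      (cone-Π∞ (λ k → cone-odd 2 refl (suc k)))) (cone-Π∞ (cone-odd 6 refl)))
      (cone-Π∞ (λ k → cone-inv refl (cone-^ (suc (suc k)) (cone-X^ 4 refl)))))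
      (cone-Π∞ (λ k → cone-inv refl (cone-* (cone-X^ 4 refl) (cone-^ k (cone-X^ 12 refl))))))
      (cone-Π∞ (λ k → cone-inv refl (cone-* (cone-X^ 8 refl) (cone-^ k (cone-X^ 12 refl))))))
    refl
    where
    open Solver
    -- Since -q^d lies in the cone, so does its square q^(2d), and the factor is 1 + (-q^d) q^(2dk).
    cone-odd : ∀ d → χ₂ d ≡ -1ℤ → ∀ k → InCone (odd-factor d k)
    cone-odd d χ≡-1 k = cone-≈
      (solve 2 (λ q r → :1 :+ (:- q) :* r := :1 :- q :* r) ≈-refl (X ^ₛ d) ((X ^ₛ d *ₛ X ^ₛ d) ^ₛ k))
      (cone-+ cone-1 (cone-* (cone--X^ d χ≡-1) (cone-^ k (cone-≈
        (solve 1 (λ q → (:- q) :* (:- q) := q :* q) ≈-refl (X ^ₛ d))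
        (cone-* (cone--X^ d χ≡-1) (cone--X^ d χ≡-1))))))

-- The dissection of f₁² f₃² / f₄³ and its coefficients

euler-double : ∀ d → euler (X ^ₛ d *ₛ X ^ₛ d) ≈ E (d + d)
euler-double d = euler-cong (≈-sym (^-homo-* X d d))

E-split : ∀ d → coeff (X ^ₛ d) 0 ≡ 0ℤ → E d ≈ O d *ₛ E (d + d)
E-split d X₀ = ≈-trans (euler≈eulerOdd*euler² X₀) (*ₛ-congˡ (euler-double d))

φ-spec : ∀ d → coeff (X ^ₛ d) 0 ≡ 0ℤ → φ⁻ (X ^ₛ d) *ₛ E (d + d) ≈ E d *ₛ E d
φ-spec d X₀ = ≈-trans (*ₛ-congˡ (≈-sym (euler-double d))) (gauss-φ⁻ X₀)

ψ-spec : ∀ d → coeff (X ^ₛ d) 0 ≡ 0ℤ → ψ (X ^ₛ d) *ₛ E d ≈ E (d + d) *ₛ E (d + d)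
ψ-spec d X₀ = ≈-trans (gauss-ψ X₀) (*ₛ-cong (euler-double d) (euler-double d))

-- Times f₄³, both summands acquire the factor f₂ f₆, which leaves `Ev` and 2 `P`, with difference
-- `T`; Gauss's product for φ(-q) at q and q³ then absorbs f₂ f₆.
dissection : E 4 ^ₛ 3 *ₛ (H -ₛ (X *ₛ K +ₛ X *ₛ K)) ≈ E 1 ^ₛ 2 *ₛ E 3 ^ₛ 2
dissection = begin
  E 4 ^ₛ 3 *ₛ (H -ₛ (X *ₛ K +ₛ X *ₛ K))
    ≈⟨ solve 4 (λ f h k x → f :* (f :* (f :* :1)) :* (h :- (x :* k :+ x :* k)) :=
         f :* (h :* f) :* f :- (x :+ x) :* ((k :* f) :* (f :* f))) ≈-refl (E 4) H K X ⟩
  E 4 *ₛ (H *ₛ E 4) *ₛ E 4 -ₛ (X +ₛ X) *ₛ ((K *ₛ E 4) *ₛ (E 4 *ₛ E 4))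
    ≈⟨ -ₛ-cong₂ even-part (*ₛ-congˡ odd-part) ⟩
  E 2 *ₛ E 6 *ₛ Ev -ₛ (X +ₛ X) *ₛ (ψ (X ^ₛ 2) *ₛ ψ (X ^ₛ 6) *ₛ (E 2 *ₛ E 6))
    -- `Ev` unfolds to `T` + 2 `P`, and the products with ψ(q²) ψ(q⁶) cancel.
    ≈⟨ solve 6 (λ x a b u v t → a :* b :* (t :+ (x :* (u :* v) :+ x :* (u :* v)))
         :- (x :+ x) :* (u :* v :* (a :* b)) := t :* (a :* b)) ≈-refl
         X (E 2) (E 6) (ψ (X ^ₛ 2)) (ψ (X ^ₛ 6)) T ⟩
  T *ₛ (E 2 *ₛ E 6)
    ≈⟨ solve 4 (λ a b c d → a :* b :* (c :* d) := a :* c :* (b :* d)) ≈-refl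
         (φ⁻ (X ^ₛ 1)) (φ⁻ (X ^ₛ 3)) (E 2) (E 6) ⟩
  φ⁻ (X ^ₛ 1) *ₛ E 2 *ₛ (φ⁻ (X ^ₛ 3) *ₛ E 6)
    ≈⟨ *ₛ-cong (φ-spec 1 refl) (φ-spec 3 refl) ⟩
  E 1 *ₛ E 1 *ₛ (E 3 *ₛ E 3)
    ≈⟨ solve 2 (λ a b → a :* a :* (b :* b) := a :* (a :* :1) :* (b :* (b :* :1))) ≈-refl (E 1) (E 3) ⟩
  E 1 ^ₛ 2 *ₛ E 3 ^ₛ 2 ∎
  where
  open Solver
  open ≈-Reasoning
  even-part : E 4 *ₛ (H *ₛ E 4) *ₛ E 4 ≈ E 2 *ₛ E 6 *ₛ Ev
  even-part = begin
    E 4 *ₛ (H *ₛ E 4) *ₛ E 4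
      ≈⟨ *ₛ-congˡ E₄-split ⟩
    E 4 *ₛ (H *ₛ E 4) *ₛ (M₄ *ₛ M₈ *ₛ E 12)
      ≈⟨ solve 5 (λ f h m n g → f :* (h :* f) :* (m :* n :* g) := h :* f :* (m :* n) :* (f :* g)) ≈-refl
           (E 4) H M₄ M₈ (E 12) ⟩
    H *ₛ E 4 *ₛ (M₄ *ₛ M₈) *ₛ (E 4 *ₛ E 12)
      ≈⟨ *ₛ-congʳ H-spec ⟩
    O 2 *ₛ O 6 *ₛ Ev *ₛ (E 4 *ₛ E 12)
      ≈⟨ solve 5 (λ a b v f g → a :* b :* v :* (f :* g) := a :* f :* (b :* g) :* v) ≈-refl
           (O 2) (O 6) Ev (E 4) (E 12) ⟩
    O 2 *ₛ E 4 *ₛ (O 6 *ₛ E 12) *ₛ Ev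
      ≈⟨ *ₛ-congʳ (*ₛ-cong (E-split 2 refl) (E-split 6 refl)) ⟨
    E 2 *ₛ E 6 *ₛ Ev ∎
  odd-part : (K *ₛ E 4) *ₛ (E 4 *ₛ E 4) ≈ ψ (X ^ₛ 2) *ₛ ψ (X ^ₛ 6) *ₛ (E 2 *ₛ E 6)
  odd-part = begin
    (K *ₛ E 4) *ₛ (E 4 *ₛ E 4)
      ≈⟨ *ₛ-cong (≈-trans K-spec (≈-sym (ψ-spec 6 refl))) (≈-sym (ψ-spec 2 refl)) ⟩
    ψ (X ^ₛ 6) *ₛ E 6 *ₛ (ψ (X ^ₛ 2) *ₛ E 2)
      ≈⟨ solve 4 (λ u a v b → u :* a :* (v :* b) := v :* u :* (b :* a)) ≈-refl
           (ψ (X ^ₛ 6)) (E 6) (ψ (X ^ₛ 2)) (E 2) ⟩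
    ψ (X ^ₛ 2) *ₛ ψ (X ^ₛ 6) *ₛ (E 2 *ₛ E 6) ∎

f≈E : ∀ d .{{_ : ℕ.NonZero d}} → series (f d) ≈ E d
f≈E d = pointwise λ n → go n n
  where
  -- Both sides read coefficient n from n factors, but induction on the factors needs all lower
  -- degrees, hence the separate N.
  go : ∀ N n → qPochhammer d N n ≡ coeff (Π (even-factor d) N) n
  go zero    n = refl
  go (suc N) n = ⊛-cong-upto n
    (λ i _ → cong (λ z → 𝟙 i ℤ.+ - z)
      (trans (sym (coeff-X^ (d * suc N) i)) (sym (at (^-assocʳ X d (suc N)) i))))
    (λ i _ → go N i)

series-^ : ∀ A n → series (A ^ n) ≈ series A ^ₛ n
series-^ A zero    = pointwise λ _ → refl
series-^ A (suc n) = ≈-trans (pointwise λ _ → refl) (*ₛ-congˡ {series A} (series-^ A n))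

a≈ : series a-1²3²4⁻³ ≈ H -ₛ (X *ₛ K +ₛ X *ₛ K)
a≈ = *ₛ-cancelˡ {E 4 ^ₛ 3} refl (begin
  E 4 ^ₛ 3 *ₛ series a-1²3²4⁻³
    ≈⟨ *ₛ-congʳ (≈-trans (series-^ (f 4) 3) (^-congˡ 3 (f≈E 4))) ⟨
  series (f 4 ^ 3) *ₛ series a-1²3²4⁻³
    ≈⟨ pointwise a-generating ⟩
  series (f 1 ^ 2) *ₛ series (f 3 ^ 2)
    ≈⟨ *ₛ-cong (≈-trans (series-^ (f 1) 2) (^-congˡ 2 (f≈E 1))) (≈-trans (series-^ (f 3) 2) (^-congˡ 2 (f≈E 3))) ⟩
  E 1 ^ₛ 2 *ₛ E 3 ^ₛ 2
    ≈⟨ dissection ⟨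
  E 4 ^ₛ 3 *ₛ (H -ₛ (X *ₛ K +ₛ X *ₛ K)) ∎)
  where open ≈-Reasoning

-- The factor q moves the pattern of `K` by one place; 3 + m replaces m - 1, to which it is
-- congruent modulo 4.
coeff-XK : ∀ m → ∃[ c ] coeff (X *ₛ K) m ≡ χ₄ (3 + m) ℤ.* + suc c
coeff-XK zero    = 0 , refl
coeff-XK (suc m) = let c , e = Fourth.strict strict-K m in c , trans (coeff-X* K m) e

coeff-a : ∀ m {x y} → χ₂ m ≡ x → χ₄ (3 + m) ≡ y → ∃[ b ] ∃[ c ]
  a-1²3²4⁻³ m ≡ x ℤ.* + suc b - (y ℤ.* + suc c ℤ.+ y ℤ.* + suc c)
coeff-a m refl refl =
  let b , eH = Alternating.strict strict-H m
      c , eK = coeff-XK m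
  in b , c , trans (at a≈ m) (cong₂ (λ h k → h - (k ℤ.+ k)) eH eK)

χ₂-period : ∀ i n → χ₂ (n * 4 + i) ≡ χ₂ i
χ₂-period i zero    = refl
χ₂-period i (suc n) = trans (ℤₚ.neg-involutive _) (χ₂-period i n)

χ₄-period : ∀ i n → χ₄ (3 + (n * 4 + i)) ≡ χ₄ (3 + i)
χ₄-period i zero    = refl
χ₄-period i (suc n) = χ₄-period i n

theorem4p7 : (n : ℕ) →
    (a-1²3²4⁻³ (4 * n) > 0ℤ) ×
    (a-1²3²4⁻³ (4 * n + 1) < 0ℤ) ×
    (a-1²3²4⁻³ (4 * n + 2) < 0ℤ) ×
    (a-1²3²4⁻³ (4 * n + 3) ≡ 0ℤ)
theorem4p7 n =
    subst (_> 0ℤ) (trans (sym e₀) (cong a-1²3²4⁻³ (trans (ℕₚ.+-identityʳ (n * 4)) (ℕₚ.*-comm n 4))))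
      (+<+ (s≤s z≤n))
  , subst (_< 0ℤ) (trans (sym e₁) (cong (λ m → a-1²3²4⁻³ (m + 1)) (ℕₚ.*-comm n 4))) -<+
  , subst (_< 0ℤ) (trans (sym e₂) (cong (λ m → a-1²3²4⁻³ (m + 2)) (ℕₚ.*-comm n 4))) -<+
  , trans (cong (λ m → a-1²3²4⁻³ (m + 3)) (ℕₚ.*-comm 4 n)) e₃
  where
  -- The pairs (`χ₂ i`, `χ₄ (3 + i)`) for i = 0, 1, 2, 3 are (1, 0), (0, 1), (-1, 0), (0, 0), so at
  -- most one summand is nonzero in each residue class. Writing n * 4 lets the periodicity follow by
  -- recursion on n.
  value : ∀ i → ∃[ b ] ∃[ c ] a-1²3²4⁻³ (n * 4 + i) ≡
    χ₂ i ℤ.* + suc b - (χ₄ (3 + i) ℤ.* + suc c ℤ.+ χ₄ (3 + i) ℤ.* + suc c)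
  value i = coeff-a (n * 4 + i) (χ₂-period i n) (χ₄-period i n)
  e₀ = proj₂ (proj₂ (value 0))
  e₁ = proj₂ (proj₂ (value 1))
  e₂ = proj₂ (proj₂ (value 2))
  e₃ = proj₂ (proj₂ (value 3))
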